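{- For all integers $k\ge 2$, \[ GR_k(W_4)= \begin{cases} 14\cdot 5^{\frac{k-2}{2}}+1, & \text{if } k \text{ is even},\\ 28\cdot 5^{\frac{k-3}{2}}+1, & \text{if } k \text{ is odd}. \end{cases} \]
   Context: A Gallai coloring of a complete graph is an edge-coloring with no rainbow triangle (a triangle whose three edges receive three distinct colors). A Gallai $k$-coloring is a Gallai coloring using at most $k$ colors. For a graph $H$ and integer $k\ge1$, the Gallai-Ramsey number $GR_k(H)$ is the least positive integer $N$ such that every Gallai $k$-coloring of the edges of the complete graph $K_N$ contains a monochromatic copy of $H$. $W_n$ denotes the wheel on $n+1$ vertices, i.e. a cycle $C_n$ together with one extra vertex adjacent to all vertices of the cycle; thus $W_4$ has 5 vertices. -}

module Defs where

open import Data.Nat using (ℕ; zero; suc; _+_; _*_; _∸_; _^_; _≤_)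
open import Data.Nat.DivMod using (_/_; _%_)
open import Data.Fin using (Fin)
import Data.Fin as Fin
open import Data.Product using (Σ; _×_)
open import Relation.Binary.PropositionalEquality using (_≡_; _≢_)
open import Function.Definitions using (Injective)
open import Relation.Nullary using (¬_)

-- An edge-colouring of the complete graph K_N (vertex set Fin N) with at most
-- k colours (colour set Fin k).  Only values on pairs of distinct vertices
-- matter; we require symmetry so it is a colouring of unordered edges.
record Colouring (N k : ℕ) : Set where
  field
    col  : Fin N → Fin N → Fin k
    symm : ∀ x y → x ≢ y → col x y ≡ col y x
open Colouring public

Rainbow : ∀ {N k} → Colouring N k → Fin N → Fin N → Fin N → Set
Rainbow c x y z =
  x ≢ y × y ≢ z × x ≢ z ×
  col c x y ≢ col c y z × col c y z ≢ col c x z × col c x y ≢ col c x z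

Gallai : ∀ {N k} → Colouring N k → Set
Gallai c = ∀ x y z → ¬ Rainbow c x y z

data W4Edge : Fin 5 → Fin 5 → Set where
  spoke1 : W4Edge Fin.zero (Fin.suc Fin.zero)
  spoke2 : W4Edge Fin.zero (Fin.suc (Fin.suc Fin.zero))
  spoke3 : W4Edge Fin.zero (Fin.suc (Fin.suc (Fin.suc Fin.zero)))
  spoke4 : W4Edge Fin.zero (Fin.suc (Fin.suc (Fin.suc (Fin.suc Fin.zero))))
  rim12  : W4Edge (Fin.suc Fin.zero) (Fin.suc (Fin.suc Fin.zero))
  rim23  : W4Edge (Fin.suc (Fin.suc Fin.zero)) (Fin.suc (Fin.suc (Fin.suc Fin.zero)))
  rim34  : W4Edge (Fin.suc (Fin.suc (Fin.suc Fin.zero))) (Fin.suc (Fin.suc (Fin.suc (Fin.suc Fin.zero))))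
  rim41  : W4Edge (Fin.suc (Fin.suc (Fin.suc (Fin.suc Fin.zero)))) (Fin.suc Fin.zero)

MonoW4 : ∀ {N k} → Colouring N k → Set
MonoW4 {N} {k} c =
  Σ (Fin 5 → Fin N) λ f → Injective _≡_ _≡_ f ×
  Σ (Fin k) λ i → ∀ u v → W4Edge u v → col c (f u) (f v) ≡ i

Arrows : ℕ → ℕ → Set
Arrows k N = (c : Colouring N k) → Gallai c → MonoW4 c

IsGR-W4 : ℕ → ℕ → Set
IsGR-W4 k N = 1 ≤ N × Arrows k N × (∀ M → 1 ≤ M → Arrows k M → N ≤ M)

grW4Value : ℕ → ℕ
grW4Value k with k % 2
... | zero  = 14 * 5 ^ ((k ∸ 2) / 2) + 1
... | suc _ = 28 * 5 ^ ((k ∸ 3) / 2) + 1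

{-# OPTIONS --safe #-}

-- Upper bound.  Give every colour a state: it avoids W₄ (full), C₄ or P₃ (matching).  If n colours are full or
-- C₄-free and c of them are C₄-free, then |X| + c ≤ f(n), where f = 2, 4, 14, 28 and f(n + 2) = 5 f(n) from then on.
-- The proof is by induction on |X|.  When X splits into two parts joined in one colour, that colour drops to a lower
-- state on both parts.  Otherwise Gallai's theorem gives two colours r, b such that the components A of the remaining
-- edges are modules.  A component with at least two vertices splits the rest of X into its r-neighbours and its
-- b-neighbours, on which r respectively b is a matching, so each of these sides consists of at most two pieces of
-- size f(n - 2), and |X| ≤ 5 f(n - 2).  If all components are single vertices then X is 2-coloured, and
-- R(C₄, W₄) ≤ 9 and R(W₄, W₄) ≤ 15 apply.
--
-- R(W₄, W₄) ≤ 15.  By the handshake lemma a 2-colouring of K₁₅ has a vertex v of degree at least eight in one colour,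
-- say red.  Eight red neighbours of v carry no red C₄ and no blue W₄, which determines their colouring up to
-- isomorphism; checking all rows then shows that v has at most three further neighbours.
--
-- Lower bound.  A circulant colouring of K₁₄ is substituted into triangle-free colourings of K₂ and K₅.

module Submission where

-- The extremal colourings are products: a pentagon multiplies the size by 5 at the price of two
-- colours, an edge multiplies it by 2 at the price of one. The upper bound has to take such a
-- product apart. The obstacle is that a colour joining two parts need not vanish inside them: it
-- can persist as a matching, or as a C₄-free graph when the other part is a single vertex. Hence
-- the three states, and an induction over all state vectors at once in which colours are weakened
-- but never deleted. Weakening W₄-free to C₄-free costs a vertex and leaves n unchanged; the
-- summand c absorbs that vertex. Since 5 f(0) = 10 < 14 and 5 f(1) = 20 < 28, products do not reach
-- the first values. The number 14 comes from R(W₄, W₄), which is where the finite computation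
-- enters. Components are available only up to double negation, which suffices because |X| + c ≤
-- f(n) is decidable.

open import Defs
open import Data.Bool as Bool using (Bool; true; false; not; _∧_; _∨_; if_then_else_)
open import Data.Bool.ListAction using (any; all)
open import Data.Bool.Properties using (T?; T-≡)
open import Data.Empty using (⊥; ⊥-elim)
open import Data.Fin as Fin using (Fin; zero; suc; toℕ; _↑ˡ_; _↑ʳ_; splitAt; #_)
import Data.Fin.Properties as Fin
open import Data.List as List using (List; []; _∷_; _++_; length; filter; take; map)
import Data.List.Properties as List
open import Data.List.Membership.Propositional using (_∈_; find; lose)
open import Data.List.Membership.Propositional.Properties using (∈-filter⁻; ∈-filter⁺; ∈-++⁺ˡ; ∈-++⁺ʳ; ∈-++⁻; ∈-∃++)
open import Data.List.Relation.Binary.Permutation.Propositional using (_↭_; ↭-refl; ↭-sym; ↭-trans; ↭-reflexive; prep; ↭⇒↭ₛ)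
open import Data.List.Relation.Binary.Permutation.Propositional.Properties using (∈-resp-↭; ↭-length; shift; shifts; ++-comm; ++⁺ˡ; ++⁺ʳ)
import Data.List.Relation.Binary.Permutation.Setoid.Properties as Permutation
open import Data.List.Relation.Unary.All as All using (All; []; _∷_)
import Data.List.Relation.Unary.All.Properties as All
open import Data.List.Relation.Unary.AllPairs using ([]; _∷_)
open import Data.List.Relation.Unary.Any using (Any; here; there; any?)
open import Data.List.Relation.Unary.Unique.Propositional using (Unique)
import Data.List.Relation.Unary.Unique.Propositional.Properties as Unique
open import Data.Nat as ℕ using (ℕ; zero; suc; _+_; _*_; _^_; _/_; _%_; _≤_; _<_; z≤n; s≤s; _≡ᵇ_; ∣_-_∣)
open import Data.Nat.DivMod.Core using (divₕ-extractAcc)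
open import Data.Nat.Divisibility using (_∣?_; divides)
open import Data.Nat.ListAction using (sum)
import Data.Nat.Properties as ℕ
open import Data.Nat.Tactic.RingSolver using (solve-∀)
open import Data.Product using (∃; ∃₂; Σ; _×_; _,_; proj₁; proj₂)
open import Data.Sum as Sum using (_⊎_; inj₁; inj₂; swap; [_,_]′)
open import Data.Unit using (⊤; tt)
open import Data.Vec as Vec using (Vec; []; _∷_; lookup; _[_]≔_)
import Data.Vec.Properties as Vec
open import Data.Vec.Relation.Unary.All as VecAll using ([]; _∷_)
import Data.Vec.Relation.Unary.All.Properties as VecAll
open import Data.Vec.Relation.Unary.AllPairs using (allPairs?; []; _∷_)
open import Data.Vec.Relation.Unary.Unique.Propositional using () renaming (Unique to UniqueVec)
open import Data.Vec.Relation.Unary.Unique.Propositional.Properties using (map⁺; lookup-injective)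
open import Function using (_∘_; id; case_of_)
open import Function.Bundles using (Equivalence)
open import Level using (0ℓ)
open import Relation.Binary.Core using (Rel)
import Relation.Binary.Definitions as B
open import Relation.Binary.PropositionalEquality
open import Relation.Nullary using (¬_; Dec; yes; no; does; ¬?; contradiction; _×-dec_; _⊎-dec_; _→-dec_)
open import Relation.Nullary.Decidable using (dec-true; dec-false; decidable-stable; ¬¬-excluded-middle; from-yes; from-no)
open import Relation.Unary using (Pred)
import Relation.Unary as U

-- P₃, C₄ and W₄ in a graph

-- W₄ = K₁,₂,₂ is two vertices b, d together with a path a - h - c in their common neighbourhood, and C₄ is two vertices
-- b, d with two common neighbours.  D is the distinctness demanded of b, d and of a, c: inequality in general, and the
-- order of Fin n where halving the search matters.
module _ {A : Set} (D : Rel A 0ℓ) where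
  Two : Pred A 0ℓ → Set
  Two Q = ∃ λ a → Q a × ∃ λ c → (D a c × Q c)

  module _ (R : Rel A 0ℓ) where
    Common : Pred A 0ℓ → A → A → Pred A 0ℓ
    Common Q b d x = R b x × R d x × Q x

    P3 C4 W4 : Pred A 0ℓ → Set
    P3 Q = ∃ λ h → Q h × Two (λ x → R h x × Q x)
    C4 Q = ∃ λ b → Q b × ∃ λ d → (D b d × Q d) × Two (Common Q b d)
    W4 Q = ∃ λ b → Q b × ∃ λ d → (D b d × Q d) × P3 (Common Q b d)

module _ {A B : Set} (f : A → B) {D : Rel A 0ℓ} {D′ : Rel B 0ℓ} (δ : ∀ {x y} → D x y → D′ (f x) (f y)) where
  Two-map : ∀ {P Q} → (∀ {x} → P x → Q (f x)) → Two D P → Two D′ Q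
  Two-map g (a , pa , c , dac , pc) = f a , g pa , f c , δ dac , g pc

  module _ {R : Rel A 0ℓ} {S : Rel B 0ℓ} (ρ : ∀ {x y} → R x y → S (f x) (f y)) where
    P3-map : ∀ {P Q} → (∀ {x} → P x → Q (f x)) → P3 D R P → P3 D′ S Q
    P3-map g (x , px , t) = f x , g px , Two-map (λ (r , p) → ρ r , g p) t

    C4-map : ∀ {P Q} → (∀ {x} → P x → Q (f x)) → C4 D R P → C4 D′ S Q
    C4-map g (b , pb , d , (dbd , pd) , t) =
      f b , g pb , f d , (δ dbd , g pd) , Two-map (λ (r , s , p) → ρ r , ρ s , g p) t

    W4-map : ∀ {P Q} → (∀ {x} → P x → Q (f x)) → W4 D R P → W4 D′ S Q
    W4-map g (b , pb , d , (dbd , pd) , t) =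
      f b , g pb , f d , (δ dbd , g pd) , P3-map (λ (r , s , p) → ρ r , ρ s , g p) t

module _ {n} {D : Rel (Fin n) 0ℓ} (D? : B.Decidable D) where
  Two? : ∀ {Q : Pred (Fin n) 0ℓ} → U.Decidable Q → Dec (Two D Q)
  Two? Q? = Fin.any? λ a → Q? a ×-dec Fin.any? λ c → D? a c ×-dec Q? c

  module _ {R : Rel (Fin n) 0ℓ} (R? : B.Decidable R) where
    Common? : ∀ {Q : Pred (Fin n) 0ℓ} → U.Decidable Q → ∀ b d → U.Decidable (Common D R Q b d)
    Common? Q? b d x = R? b x ×-dec R? d x ×-dec Q? x

    P3? : ∀ {Q : Pred (Fin n) 0ℓ} → U.Decidable Q → Dec (P3 D R Q)
    P3? Q? = Fin.any? λ h → Q? h ×-dec Two? (λ x → R? h x ×-dec Q? x)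

    C4? : ∀ {Q : Pred (Fin n) 0ℓ} → U.Decidable Q → Dec (C4 D R Q)
    C4? Q? = Fin.any? λ b → Q? b ×-dec Fin.any? λ d → (D? b d ×-dec Q? d) ×-dec Two? (Common? Q? b d)

    W4? : ∀ {Q : Pred (Fin n) 0ℓ} → U.Decidable Q → Dec (W4 D R Q)
    W4? Q? = Fin.any? λ b → Q? b ×-dec Fin.any? λ d → (D? b d ×-dec Q? d) ×-dec P3? (Common? Q? b d)

-- The catalogue of small colourings

-- A graph on n ordered vertices: each row lists the adjacency of a vertex to the later ones.
infixr 5 _∷_
data Code : ℕ → Set where
  []  : Code 0
  _∷_ : ∀ {n} → Vec Bool n → Code n → Code (suc n)

adj : ∀ {n} → Code n → Fin n → Fin n → Bool
adj (r ∷ c) zero    zero    = false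
adj (r ∷ c) zero    (suc j) = lookup r j
adj (r ∷ c) (suc i) zero    = lookup r i
adj (r ∷ c) (suc i) (suc j) = adj c i j

code : ∀ {A : Set} {n} → (A → A → Bool) → Vec A n → Code n
code χ []       = []
code χ (a ∷ as) = Vec.map (χ a) as ∷ code χ as

complement : ∀ {n} → Code n → Code n
complement []      = []
complement (r ∷ c) = Vec.map not r ∷ complement c

_==_ : ∀ {n} → Vec Bool n → Vec Bool n → Bool
[]      == []      = true
(true ∷ r) == (y ∷ s) = y ∧ r == s
(false ∷ r) == (y ∷ s) = not y ∧ r == s

_===_ : ∀ {n} → Code n → Code n → Bool
[]      === []      = true
(r ∷ c) === (s ∷ d) = r == s ∧ c === d

Edge : ∀ {n} → Code n → Fin n → Fin n → Set
Edge c i j = Bool.T (adj c i j)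

everything? : ∀ {n} (i : Fin n) → Dec ⊤
everything? i = yes tt

-- Opaque so that comparing two symbolic codes does not unfold the search.
opaque
  hasC4 hasW4 : ∀ {n} → Code n → Bool
  hasC4 c = does (C4? Fin._<?_ (λ i j → T? (adj c i j)) everything?)
  hasW4 c = does (W4? Fin._<?_ (λ i j → T? (adj c i j)) everything?)

everyRow : ∀ n → (Vec Bool n → Bool) → Bool
everyRow zero    f = f []
everyRow (suc n) f = everyRow n (λ r → f (true ∷ r)) ∧ everyRow n (λ r → f (false ∷ r))

value : ∀ {n} → Vec Bool n → ℕ
value []          = 0
value (true  ∷ r) = 1 + 2 * value r
value (false ∷ r) = 2 * value r

-- Rows and codes are written as numbers, least significant bit first, and arrangements as numbers whose decimal digits
-- are the positions, last digit first.
takeRow : ∀ n → ℕ → Vec Bool n × ℕ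
takeRow zero    m = [] , m
takeRow (suc n) m = let r , m′ = takeRow n (m / 2) in ((m % 2) ≡ᵇ 1) ∷ r , m′

decode : ∀ n → ℕ → Code n
decode zero    m = []
decode (suc n) m = let r , m′ = takeRow n m in r ∷ decode n m′

digit : ∀ n → ℕ → Fin (suc n)
digit zero    d       = zero
digit (suc n) zero    = zero
digit (suc n) (suc d) = suc (digit n d)

arrangement : ∀ n m → ℕ → Vec (Fin (suc n)) m
arrangement n zero    d = []
arrangement n (suc m) d = digit n (d % 10) ∷ arrangement n m (d / 10)

-- Each code comes with the rows by which it can be extended, each with an arrangement that carries the extension to a
-- code of the next catalogue.
Catalogue : Set
Catalogue = List (ℕ × List (ℕ × ℕ))

listed : ∀ {n} → Catalogue → Code n → Bool
listed {n} L c = any (λ e → decode n (proj₁ e) === c) L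

injective? : ∀ {m n} (p : Vec (Fin n) m) → Dec (UniqueVec p)
injective? = allPairs? (λ i j → ¬? (i Fin.≟ j))

rearranges : ∀ {n} → Catalogue → Code n → Vec (Fin n) n → Bool
rearranges L c p = does (injective? p) ∧ listed L (code (adj c) p)

-- A hint is a certificate: any permutation that carries the extension to a listed code settles the
-- row, so isomorphism is never decided. Only rows without a forbidden subgraph need a hint.
extends : ∀ {n} → Catalogue → List (ℕ × ℕ) → Vec Bool n → Code n → Bool
extends {n} L hints r c =
  hasC4 (r ∷ c) ∨ hasW4 (complement (r ∷ c)) ∨
  any (λ h → (proj₁ h ≡ᵇ value r) ∧ rearranges L (r ∷ c) (arrangement n (suc n) (proj₂ h))) hints

step : ℕ → Catalogue → Catalogue → Bool
step n L L′ = all (λ e → let c = decode n (proj₁ e) in everyRow n (λ r → extends L′ (proj₂ e) r c)) L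

-- The C₄-free graphs on n vertices with W₄-free complement, up to isomorphism, found by a computer search.  There are
-- none on nine vertices.
level0 : Catalogue
level0 =
  (0 , (0 , 0) ∷ []) ∷ []

level1 : Catalogue
level1 =
  (0 , (0 , 10) ∷ (1 , 10) ∷ []) ∷ []

level2 : Catalogue
level2 =
  (0 , (0 , 210) ∷ (1 , 120) ∷ (2 , 210) ∷ (3 , 210) ∷ []) ∷
  (1 , (0 , 201) ∷ (1 , 201) ∷ (2 , 102) ∷ (3 , 210) ∷ []) ∷ []

level3 : Catalogue
level3 =
  (0 , (0 , 3210) ∷ (1 , 1320) ∷ (2 , 2310) ∷ (3 , 2130) ∷ (4 , 3210) ∷ (5 , 3120) ∷ (6 , 3210) ∷ (7 , 3210) ∷ []) ∷
  (2 , (0 , 3201) ∷ (1 , 3021) ∷ (2 , 3210) ∷ (3 , 1230) ∷ (4 , 1023) ∷ (5 , 3210) ∷ (6 , 3210) ∷ (7 , 3210) ∷ []) ∷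
  (3 , (0 , 3201) ∷ (1 , 3201) ∷ (2 , 2301) ∷ (3 , 2301) ∷ (4 , 3201) ∷ (5 , 3201) ∷ []) ∷
  (7 , (0 , 3021) ∷ (1 , 3021) ∷ (2 , 3012) ∷ (4 , 2013) ∷ []) ∷ []

level4 : Catalogue
level4 =
  (0 , (3 , 21430) ∷ (5 , 31420) ∷ (6 , 32410) ∷ (7 , 32140) ∷ (9 , 41320) ∷ (10 , 42310) ∷ (11 , 42130) ∷
    (12 , 43210) ∷ (13 , 43120) ∷ (14 , 43210) ∷ (15 , 43210) ∷ []) ∷
  (4 , (1 , 40321) ∷ (3 , 12340) ∷ (5 , 13240) ∷ (6 , 43210) ∷ (7 , 13240) ∷ (8 , 10324) ∷ (9 , 43210) ∷
    (10 , 42310) ∷ (11 , 42310) ∷ (12 , 43210) ∷ (13 , 43210) ∷ (14 , 43210) ∷ (15 , 43210) ∷ []) ∷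
  (6 , (0 , 43201) ∷ (1 , 43021) ∷ (2 , 24301) ∷ (3 , 4321) ∷ (4 , 34201) ∷ (5 , 34201) ∷ (6 , 34210) ∷
    (7 , 34210) ∷ (8 , 43201) ∷ (9 , 43201) ∷ (10 , 43210) ∷ (11 , 43210) ∷ []) ∷
  (7 , (0 , 43201) ∷ (1 , 43201) ∷ (2 , 24301) ∷ (3 , 24301) ∷ (4 , 34201) ∷ (5 , 34201) ∷ (8 , 43201) ∷
    (9 , 43201) ∷ []) ∷
  (18 , (1 , 43021) ∷ (2 , 34012) ∷ (3 , 4321) ∷ (4 , 41023) ∷ (5 , 34120) ∷ (6 , 1432) ∷ (7 , 32140) ∷
    (8 , 32014) ∷ (9 , 2341) ∷ (10 , 43210) ∷ (11 , 41230) ∷ (12 , 2143) ∷ (13 , 34120) ∷ (14 , 43210) ∷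
    (15 , 43210) ∷ []) ∷
  (22 , (0 , 43021) ∷ (1 , 43021) ∷ (2 , 40321) ∷ (4 , 12043) ∷ (5 , 34021) ∷ (6 , 43210) ∷ (8 , 12034) ∷
    (9 , 2341) ∷ (10 , 21034) ∷ []) ∷
  (21 , (0 , 43021) ∷ (1 , 40321) ∷ (2 , 40312) ∷ (4 , 43201) ∷ (5 , 40231) ∷ (6 , 40132) ∷ (8 , 20314) ∷
    (12 , 20134) ∷ []) ∷
  (23 , (0 , 43021) ∷ (1 , 43021) ∷ (2 , 40321) ∷ (4 , 43201) ∷ (5 , 43201) ∷ (8 , 20341) ∷ []) ∷ []

level5 : Catalogue
level5 =
  (12 , (6 , 543210) ∷ (7 , 543210) ∷ (11 , 452310) ∷ (13 , 453210) ∷ (14 , 453210) ∷ (15 , 453210) ∷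
    (19 , 542310) ∷ (21 , 543210) ∷ (22 , 543210) ∷ (23 , 543210) ∷ []) ∷
  (14 , (6 , 325401) ∷ (7 , 325401) ∷ (10 , 425301) ∷ (11 , 425301) ∷ (18 , 524301) ∷ (19 , 524301) ∷ []) ∷
  (15 , []) ∷
  (76 , (6 , 123450) ∷ (10 , 543210) ∷ (12 , 543210) ∷ (13 , 123450) ∷ (14 , 543210) ∷ (17 , 24351) ∷
    (21 , 543210) ∷ (22 , 543210) ∷ []) ∷
  (70 , (2 , 504321) ∷ (3 , 54321) ∷ (6 , 234501) ∷ (7 , 54321) ∷ (10 , 243501) ∷ (11 , 53421) ∷ (16 , 204351) ∷
    (17 , 24351) ∷ (18 , 543210) ∷ (19 , 543210) ∷ (20 , 534201) ∷ (21 , 24351) ∷ (22 , 534210) ∷ (23 , 534210) ∷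
    (24 , 543201) ∷ (25 , 23451) ∷ (26 , 543210) ∷ (27 , 543210) ∷ []) ∷
  (78 , (2 , 504321) ∷ (6 , 234501) ∷ (10 , 243501) ∷ (16 , 204351) ∷ (17 , 24351) ∷ (18 , 243015) ∷ []) ∷
  (73 , (12 , 543201) ∷ (13 , 543201) ∷ (14 , 543102) ∷ (28 , 243105) ∷ []) ∷
  (77 , (2 , 504321) ∷ (6 , 234501) ∷ (12 , 543201) ∷ (13 , 543201) ∷ (16 , 204351) ∷ (20 , 534201) ∷ []) ∷
  (79 , (2 , 504321) ∷ (16 , 204351) ∷ []) ∷
  (106 , (1 , 543021) ∷ (2 , 534012) ∷ (4 , 354012) ∷ (5 , 354021) ∷ (6 , 354012) ∷ (8 , 453021) ∷ (9 , 453021) ∷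
    (10 , 453012) ∷ (12 , 543210) ∷ (13 , 534120) ∷ (14 , 543210) ∷ (17 , 543021) ∷ (18 , 534012) ∷ []) ∷
  (107 , (0 , 543021) ∷ (1 , 543021) ∷ (2 , 534012) ∷ (4 , 104532) ∷ (5 , 354021) ∷ (8 , 203541) ∷ (10 , 453012) ∷
    (12 , 453201) ∷ (16 , 543021) ∷ []) ∷
  (298 , (2 , 540321) ∷ (3 , 504321) ∷ (6 , 504123) ∷ (8 , 520341) ∷ (9 , 502341) ∷ (10 , 543210) ∷ (11 , 145230) ∷
    (12 , 502143) ∷ (14 , 345210) ∷ (18 , 304125) ∷ (24 , 302145) ∷ (26 , 543210) ∷ []) ∷
  (302 , (2 , 540321) ∷ (4 , 120543) ∷ (6 , 54321) ∷ (8 , 520341) ∷ (9 , 502341) ∷ (10 , 452301) ∷ (16 , 120345) ∷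
    (18 , 34521) ∷ []) ∷
  (303 , (2 , 540321) ∷ (4 , 450231) ∷ (8 , 520341) ∷ (16 , 430251) ∷ []) ∷
  (358 , (0 , 540321) ∷ (1 , 540321) ∷ (2 , 340512) ∷ (4 , 450123) ∷ (5 , 504321) ∷ (8 , 510234) ∷ (9 , 203451) ∷
    (10 , 105432) ∷ (16 , 430215) ∷ (18 , 304512) ∷ (20 , 201543) ∷ []) ∷ []

level6 : Catalogue
level6 =
  (390 , (23 , 5634210) ∷ (27 , 5643210) ∷ (39 , 6534210) ∷ (43 , 6543210) ∷ []) ∷
  (406 , (22 , 6534210) ∷ (26 , 6543210) ∷ []) ∷
  (405 , (13 , 6543201) ∷ (22 , 6453102) ∷ (28 , 5643201) ∷ []) ∷
  (391 , []) ∷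
  (407 , []) ∷
  (2444 , (12 , 6543210) ∷ (13 , 1234560) ∷ (21 , 1234560) ∷ (42 , 6543210) ∷ (44 , 6543210) ∷ (45 , 6543210) ∷ []) ∷
  (2442 , (13 , 654321) ∷ (25 , 234561) ∷ (26 , 164532) ∷ (42 , 354612) ∷ (44 , 214653) ∷ []) ∷
  (2454 , (20 , 1204653) ∷ (24 , 6543201) ∷ (25 , 6543201) ∷ (26 , 6543210) ∷ (34 , 534216) ∷ []) ∷
  (2446 , (34 , 3054612) ∷ (42 , 6543210) ∷ []) ∷
  (2453 , (12 , 2345601) ∷ (20 , 1354602) ∷ (24 , 6543201) ∷ (28 , 6543201) ∷ []) ∷
  (2258 , []) ∷
  (2266 , (6 , 654321) ∷ (12 , 3456021) ∷ (14 , 654321) ∷ (34 , 354621) ∷ (40 , 6453021) ∷ (42 , 354621) ∷ []) ∷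
  (2259 , []) ∷
  (2267 , (4 , 6054321) ∷ (12 , 3456021) ∷ (32 , 3054621) ∷ (40 , 6453021) ∷ []) ∷
  (3404 , (9 , 4650231) ∷ (10 , 4560132) ∷ (17 , 5640321) ∷ (20 , 5460123) ∷ (34 , 6540312) ∷ (36 , 6450213) ∷ []) ∷
  (3406 , (2 , 6540321) ∷ (9 , 4650231) ∷ (10 , 1065432) ∷ (16 , 5640321) ∷ (18 , 5640321) ∷ (34 , 6540321) ∷
    (36 , 6450213) ∷ []) ∷
  (9546 , []) ∷
  (9562 , (6 , 1405632) ∷ (12 , 6502143) ∷ (18 , 1403652) ∷ (24 , 1203654) ∷ []) ∷ []

level7 : Catalogue
level7 =
  (25003 , []) ∷
  (26010 , []) ∷
  (156428 , []) ∷
  (156460 , (42 , 76543210) ∷ []) ∷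
  (156458 , (26 , 23456701) ∷ (42 , 21465703) ∷ []) ∷
  (156461 , []) ∷
  (157082 , (40 , 46570123) ∷ []) ∷
  (156586 , []) ∷ []

level8 : Catalogue
level8 =
  (20026922 , []) ∷ []

levels : ℕ → Catalogue
levels 0 = level0
levels 1 = level1
levels 2 = level2
levels 3 = level3
levels 4 = level4
levels 5 = level5
levels 6 = level6
levels 7 = level7
levels 8 = level8
levels _ = []

opaque
  unfolding hasC4

  -- At `n = 8` the target is empty, so every row added to the only code on eight vertices creates a
  -- C₄ or a W₄ in the complement; this is R(C₄, W₄) ≤ 9. From 9 on the source is empty and the
  -- check is vacuous.
  levels-step : ∀ n → step n (levels n) (levels (suc n)) ≡ true
  levels-step 0 = refl
  levels-step 1 = refl
  levels-step 2 = refl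
  levels-step 3 = refl
  levels-step 4 = refl
  levels-step 5 = refl
  levels-step 6 = refl
  levels-step 7 = refl
  levels-step 8 = refl
  levels-step (suc (suc (suc (suc (suc (suc (suc (suc (suc _))))))))) = refl

-- Two triangles joined by one edge and two paths of length two: the triangular prism with two of
-- its three rungs subdivided.
H₈ : Code 8
H₈ = decode 8 20026922

monochromatic : ∀ {n} → Code n → Bool
monochromatic c = hasW4 c ∨ hasW4 (complement c)

fromValue : ∀ n → ℕ → Vec Bool n
fromValue n m = proj₁ (takeRow n m)

-- The six possible rows of a vertex joined in blue to the centre of hubCode, paired so that two vertices with rows from
-- the same class cannot both occur.
rowClass : Fin 3 → List ℕ
rowClass zero             = 90 ∷ 106 ∷ []
rowClass (suc zero)       = 99 ∷ 141 ∷ []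
rowClass (suc (suc zero)) = 172 ∷ 180 ∷ []

hubCode : Code 9
hubCode = Vec.replicate 8 true ∷ H₈

inClass : Fin 3 → Vec Bool 8 → Bool
inClass i r = any (λ m → r == fromValue 8 m) (rowClass i)

classified : Vec Bool 8 → Bool
classified r = inClass zero r ∨ inClass (suc zero) r ∨ inClass (suc (suc zero)) r

opaque
  unfolding hasC4

  rows-classified : everyRow 8 (λ r → monochromatic ((false ∷ r) ∷ hubCode) ∨ classified r) ≡ true
  rows-classified = refl

twoRows : Bool → ℕ → ℕ → Bool
twoRows e m m′ = monochromatic ((e ∷ false ∷ fromValue 8 m) ∷ (false ∷ fromValue 8 m′) ∷ hubCode)

-- A row is also compared with itself, since two vertices may have equal rows; so each class admits
-- one vertex rather than one vertex per row. Both colours of the edge between the two vertices are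
-- tried.
clash : Fin 3 → Bool
clash i = all (λ m → all (λ m′ → twoRows true m m′ ∧ twoRows false m m′) (rowClass i)) (rowClass i)

opaque
  unfolding hasC4

  classes-clash : ∀ i → clash i ≡ true
  classes-clash zero             = refl
  classes-clash (suc zero)       = refl
  classes-clash (suc (suc zero)) = refl

-- Soundness of the catalogue

does-sound : ∀ {P : Set} (P? : Dec P) → does P? ≡ true → P
does-sound (yes p) _ = p

∧-split : ∀ {x y} → x ∧ y ≡ true → x ≡ true × y ≡ true
∧-split {true} {true} _ = refl , refl

∨-split : ∀ {x y} → x ∨ y ≡ true → x ≡ true ⊎ y ≡ true
∨-split {true}  _ = inj₁ refl
∨-split {false} e = inj₂ e

any-sound : ∀ {A : Set} (p : A → Bool) xs → any p xs ≡ true → ∃ λ x → x ∈ xs × p x ≡ true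
any-sound p (x ∷ xs) e with ∨-split {p x} e
... | inj₁ px = x , here refl , px
... | inj₂ e′ with any-sound p xs e′
...   | y , y∈xs , py = y , there y∈xs , py

all-sound : ∀ {A : Set} (p : A → Bool) {xs} → all p xs ≡ true → ∀ {x} → x ∈ xs → p x ≡ true
all-sound p {_ ∷ xs} e (here refl) = proj₁ (∧-split e)
all-sound p {x ∷ xs} e (there x∈xs) = all-sound p {xs} (proj₂ (∧-split {p x} e)) x∈xs

everyRow-sound : ∀ {n} f → everyRow n f ≡ true → ∀ r → f r ≡ true
everyRow-sound f e []          = e
everyRow-sound {suc n} f e (true  ∷ r) = everyRow-sound _ (proj₁ (∧-split e)) r
everyRow-sound {suc n} f e (false ∷ r) =
  everyRow-sound _ (proj₂ (∧-split {everyRow n (λ r → f (true ∷ r))} e)) r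

==-sound : ∀ {n} (r s : Vec Bool n) → r == s ≡ true → r ≡ s
==-sound []          []          e = refl
==-sound (true  ∷ r) (true  ∷ s) e = cong (true ∷_) (==-sound r s e)
==-sound (false ∷ r) (false ∷ s) e = cong (false ∷_) (==-sound r s e)

===-sound : ∀ {n} (c d : Code n) → c === d ≡ true → c ≡ d
===-sound []      []      e = refl
===-sound (r ∷ c) (s ∷ d) e with ∧-split {r == s} e
... | e₁ , e₂ = cong₂ _∷_ (==-sound r s e₁) (===-sound c d e₂)

adj-diagonal : ∀ {n} (c : Code n) i → adj c i i ≡ false
adj-diagonal (r ∷ c) zero    = refl
adj-diagonal (r ∷ c) (suc i) = adj-diagonal c i

adj-complement : ∀ {n} (c : Code n) {i j} → i ≢ j → adj (complement c) i j ≡ not (adj c i j)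
adj-complement (r ∷ c) {zero}  {zero}  i≢j = contradiction refl i≢j
adj-complement (r ∷ c) {zero}  {suc j} i≢j = Vec.lookup-map j not r
adj-complement (r ∷ c) {suc i} {zero}  i≢j = Vec.lookup-map i not r
adj-complement (r ∷ c) {suc i} {suc j} i≢j = adj-complement c (i≢j ∘ cong suc)

module _ {A : Set} (χ : A → A → Bool) (χ-sym : ∀ x y → χ x y ≡ χ y x) (χ-irr : ∀ x → χ x x ≡ false) where
  adj-code : ∀ {n} (as : Vec A n) i j → adj (code χ as) i j ≡ χ (lookup as i) (lookup as j)
  adj-code (a ∷ as) zero    zero    = sym (χ-irr a)
  adj-code (a ∷ as) zero    (suc j) = Vec.lookup-map j (χ a) as
  adj-code (a ∷ as) (suc i) zero    = trans (Vec.lookup-map i (χ a) as) (χ-sym a _)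
  adj-code (a ∷ as) (suc i) (suc j) = adj-code as i j

  code-rearrange : ∀ {m n} (as : Vec A n) (p : Vec (Fin n) m) →
                   code χ (Vec.map (lookup as) p) ≡ code (adj (code χ as)) p
  code-rearrange as []      = refl
  code-rearrange as (i ∷ p) = cong₂ _∷_
    (trans (sym (Vec.map-∘ (χ (lookup as i)) (lookup as) p))
           (Vec.map-cong (λ j → sym (adj-code as i j)) p))
    (code-rearrange as p)

-- A code records R alone. Pairs outside R are read as B through `total`, which therefore is
-- demanded only inside P.
record TwoColoured {A : Set} (R B : Rel A 0ℓ) (P : Pred A 0ℓ) : Set where
  field
    R?    : ∀ x y → Dec (R x y)
    R-sym : ∀ {x y} → R x y → R y x
    R-irr : ∀ {x} → ¬ R x x
    total : ∀ {x y} → P x → P y → x ≢ y → R x y ⊎ B x y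

  χ : A → A → Bool
  χ x y = does (R? x y)

  χ-sym : ∀ x y → χ x y ≡ χ y x
  χ-sym x y with R? x y
  ... | yes r = sym (dec-true (R? y x) (R-sym r))
  ... | no ¬r = sym (dec-false (R? y x) (¬r ∘ R-sym))

  χ-irr : ∀ x → χ x x ≡ false
  χ-irr x = dec-false (R? x x) R-irr

module Ramsey {A : Set} {R B : Rel A 0ℓ} {P : Pred A 0ℓ} (two : TwoColoured R B P) where
  open TwoColoured two

  module _ {n} (as : Vec A n) (unique : UniqueVec as) (inP : ∀ i → P (lookup as i)) where
    distinct : ∀ {i j} → i Fin.< j → lookup as i ≢ lookup as j
    distinct i<j e = Fin.<⇒≢ i<j (lookup-injective unique _ _ e)

    red : ∀ {i j} → Edge (code χ as) i j → R (lookup as i) (lookup as j)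
    red {i} {j} e = does-sound (R? _ _) (trans (sym (adj-code χ χ-sym χ-irr as i j)) (Equivalence.to T-≡ e))

    blue : ∀ {i j} → Edge (complement (code χ as)) i j → B (lookup as i) (lookup as j)
    blue {i} {j} e with i Fin.≟ j
    ... | yes refl = ⊥-elim (subst Bool.T (adj-diagonal (complement (code χ as)) i) e)
    ... | no i≢j with total (inP i) (inP j) (i≢j ∘ lookup-injective unique i j)
    ...   | inj₂ b = b
    ...   | inj₁ r = ⊥-elim (subst Bool.T
              (trans (adj-complement (code χ as) i≢j)
                     (cong not (trans (adj-code χ χ-sym χ-irr as i j) (dec-true (R? _ _) r)))) e)

    opaque
      unfolding hasC4

      hasC4-sound : hasC4 (code χ as) ≡ true → C4 _≢_ R P
      hasC4-sound e = C4-map (lookup as) distinct (λ {i} {j} → red {i} {j}) (λ {i} _ → inP i)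
                        (does-sound (C4? Fin._<?_ (λ i j → T? (adj (code χ as) i j)) everything?) e)

      hasW4-sound : hasW4 (code χ as) ≡ true → W4 _≢_ R P
      hasW4-sound e = W4-map (lookup as) distinct (λ {i} {j} → red {i} {j}) (λ {i} _ → inP i)
                        (does-sound (W4? Fin._<?_ (λ i j → T? (adj (code χ as) i j)) everything?) e)

      hasW4-complement-sound : hasW4 (complement (code χ as)) ≡ true → W4 _≢_ B P
      hasW4-complement-sound e = W4-map (lookup as) distinct (λ {i} {j} → blue {i} {j}) (λ {i} _ → inP i)
                        (does-sound (W4? Fin._<?_ (λ i j → T? (adj (complement (code χ as)) i j)) everything?) e)

  -- Each arrangement reorders the points, so the record asks for membership in Q and not for a
  -- particular enumeration.
  record Realises (n : ℕ) (L : Catalogue) (Q : Pred A 0ℓ) : Set where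
    constructor realises
    field
      points  : Vec A n
      unique  : UniqueVec points
      inside  : ∀ i → Q (lookup points i)
      isListed : listed L (code χ points) ≡ true

  open Realises

  module _ (noC4 : ¬ C4 _≢_ R P) (noW4 : ¬ W4 _≢_ B P) where
    extend-code : ∀ {n L′} hints {Q} → (∀ {x} → Q x → P x) →
                  ∀ (as : Vec A n) → UniqueVec as → (∀ i → Q (lookup as i)) → ∀ {a} → P a → ¬ Q a →
                  extends L′ hints (Vec.map (χ a) as) (code χ as) ≡ true →
                  Realises (suc n) L′ (λ x → x ≡ a ⊎ Q x)
    extend-code {n} {L′} hints {Q} Q⊆P as unique inQ {a} Pa ¬Qa found =
      case ∨-split {hasC4 (code χ (a ∷ as))} found of λ where
        (inj₁ c4) → contradiction (hasC4-sound (a ∷ as) unique′ inP′ c4) noC4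
        (inj₂ found′) → case ∨-split {hasW4 (complement (code χ (a ∷ as)))} found′ of λ where
          (inj₁ w4) → contradiction (hasW4-complement-sound (a ∷ as) unique′ inP′ w4) noW4
          (inj₂ hinted) → rearranged (any-sound (λ h → (proj₁ h ≡ᵇ value (Vec.map (χ a) as)) ∧
                     rearranges L′ (code χ (a ∷ as)) (arrangement n (suc n) (proj₂ h))) hints hinted)
      where
      unique′ : UniqueVec (a ∷ as)
      unique′ = VecAll.lookup⁻ (λ i e → ¬Qa (subst Q (sym e) (inQ i))) ∷ unique

      inQ′ : ∀ i → lookup (a ∷ as) i ≡ a ⊎ Q (lookup (a ∷ as) i)
      inQ′ zero    = inj₁ refl
      inQ′ (suc i) = inj₂ (inQ i)

      inP′ : ∀ i → P (lookup (a ∷ as) i)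
      inP′ zero    = Pa
      inP′ (suc i) = Q⊆P (inQ i)

      rearranged : (∃ λ h → h ∈ hints × ((proj₁ h ≡ᵇ value (Vec.map (χ a) as)) ∧
                     rearranges L′ (code χ (a ∷ as)) (arrangement n (suc n) (proj₂ h))) ≡ true) →
                   Realises (suc n) L′ (λ x → x ≡ a ⊎ Q x)
      rearranged (h , _ , ok) = record
        { points   = Vec.map (lookup (a ∷ as)) p
        ; unique   = map⁺ (λ {i} {j} → lookup-injective unique′ i j) (does-sound (injective? p) (proj₁ split))
        ; inside   = λ i → subst (λ x → x ≡ a ⊎ Q x) (sym (Vec.lookup-map i (lookup (a ∷ as)) p)) (inQ′ (lookup p i))
        ; isListed = trans (cong (listed L′) (code-rearrange χ χ-sym χ-irr (a ∷ as) p)) (proj₂ split)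
        }
        where
        p : Vec (Fin (suc n)) (suc n)
        p = arrangement n (suc n) (proj₂ h)

        split : does (injective? p) ≡ true × listed L′ (code (adj (code χ (a ∷ as))) p) ≡ true
        split = ∧-split (proj₂ (∧-split {proj₁ h ≡ᵇ value (Vec.map (χ a) as)} ok))

    extend : ∀ n L L′ → step n L L′ ≡ true → ∀ {Q} → (∀ {x} → Q x → P x) →
             Realises n L Q → ∀ {a} → P a → ¬ Q a →
             Realises (suc n) L′ (λ x → x ≡ a ⊎ Q x)
    extend n L L′ stepped {Q} Q⊆P (realises as unique inQ lst) {a} Pa ¬Qa =
      let e , e∈L , eq = any-sound (λ e → decode n (proj₁ e) === code χ as) L lst
          found = everyRow-sound (λ r → extends L′ (proj₂ e) r (decode n (proj₁ e)))
                    (all-sound (λ e → everyRow n (λ r → extends L′ (proj₂ e) r (decode n (proj₁ e)))) {L} stepped e∈L)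
                    (Vec.map (χ a) as)
      in extend-code {n} {L′} (proj₂ e) Q⊆P as unique inQ Pa ¬Qa
           (subst (λ c → extends L′ (proj₂ e) (Vec.map (χ a) as) c ≡ true)
                  (===-sound (decode n (proj₁ e)) (code χ as) eq) found)

    Realises-map : ∀ {n L} {Q Q′ : Pred A 0ℓ} → (∀ {x} → Q x → Q′ x) → Realises n L Q → Realises n L Q′
    Realises-map g (realises as u q k) = realises as u (λ i → g (q i)) k

    -- Both conditions are hereditary, so every admissible graph is reached by adding its vertices
    -- one at a time.
    climb : ∀ {as} → Unique as → (∀ {x} → x ∈ as → P x) → Realises (length as) (levels (length as)) (_∈ as)
    climb {[]}     _            inP = realises [] [] (λ ()) refl
    climb {a ∷ as} (a∉as ∷ uni) inP =
      Realises-map (λ { (inj₁ refl) → here refl ; (inj₂ x∈as) → there x∈as })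
        (extend (length as) (levels (length as)) (levels (suc (length as))) (levels-step (length as)) {_∈ as}
                (inP ∘ there) (climb uni (inP ∘ there)) (inP (here refl))
                (λ a∈as → All.lookup a∉as a∈as refl))

    no-nine : ∀ {as} → Unique as → (∀ {x} → x ∈ as → P x) → length as ≢ 9
    no-nine {as} uni inP l =
      contradiction (isListed (subst (λ n → Realises n (levels n) (_∈ as)) l (climb uni inP))) λ ()

-- A vertex of degree eight

map-constant : ∀ {A B : Set} {n} (f : A → B) {b} (as : Vec A n) → (∀ i → f (lookup as i) ≡ b) →
               Vec.map f as ≡ Vec.replicate n b
map-constant f []       e = refl
map-constant f (a ∷ as) e = cong₂ _∷_ (e zero) (map-constant f as (e ∘ suc))

bool-cases : ∀ {e} (p : Bool → Bool) → p true ∧ p false ≡ true → p e ≡ true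
bool-cases {true}  p h = proj₁ (∧-split h)
bool-cases {false} p h = proj₂ (∧-split {p true} h)

module _ {A : Set} {R B : Rel A 0ℓ} {P : Pred A 0ℓ} (two : TwoColoured R B P)
         (noR : ¬ W4 _≢_ R P) (noB : ¬ W4 _≢_ B P) where
  open TwoColoured two

  neighbourhood : ∀ v → TwoColoured R B (λ x → R v x × P x)
  neighbourhood v = record { R? = R? ; R-sym = R-sym ; R-irr = R-irr ; total = λ (_ , p) (_ , q) → total p q }

  -- The vertex `v` completes a C₄ among its neighbours to a wheel: it becomes the middle `h` of the
  -- path, that is, the hub.
  neighbourhood-noC4 : ∀ {v} → P v → ¬ C4 _≢_ R (λ x → R v x × P x)
  neighbourhood-noC4 {v} Pv (b , (vb , Pb) , d , (b≢d , (vd , Pd)) , t) =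
    noR (b , Pb , d , (b≢d , Pd) , v , (R-sym vb , R-sym vd , Pv) ,
         Two-map id id (λ (ba , da , va , Pa) → va , ba , da , Pa) t)

  neighbourhood-noW4 : ∀ {v} → ¬ W4 _≢_ B (λ x → R v x × P x)
  neighbourhood-noW4 = noB ∘ W4-map id id id proj₂

  degree≢9 : ∀ {v X} → P v → Unique X → (∀ {x} → x ∈ X → R v x × P x) → length X ≢ 9
  degree≢9 {v} Pv = Ramsey.no-nine (neighbourhood v) (neighbourhood-noC4 Pv) neighbourhood-noW4

  not-monochromatic : ∀ {n} (as : Vec A n) → UniqueVec as → (∀ i → P (lookup as i)) →
                      monochromatic (code χ as) ≢ true
  not-monochromatic as unique inP e = case ∨-split {hasW4 (code χ as)} e of λ where
    (inj₁ w) → noR (Ramsey.hasW4-sound two as unique inP w)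
    (inj₂ w) → noB (Ramsey.hasW4-complement-sound two as unique inP w)

  module _ {v} (Pv : P v) {X : List A} (X-unique : Unique X) (X-red : ∀ {x} → x ∈ X → R v x × P x)
           (X-length : length X ≡ 8) where
    realised : Ramsey.Realises (neighbourhood v) 8 (levels 8) (_∈ X)
    realised = subst (λ n → Ramsey.Realises (neighbourhood v) n (levels n) (_∈ X)) X-length
      (Ramsey.climb (neighbourhood v) (neighbourhood-noC4 Pv) neighbourhood-noW4 X-unique X-red)

    open Ramsey.Realises realised

    v≢points : ∀ i → v ≢ lookup points i
    v≢points i e = R-irr (subst (R v) (sym e) (proj₁ (X-red (inside i))))

    points-code : code χ points ≡ H₈
    points-code = sym (===-sound H₈ (code χ points) (case ∨-split {H₈ === code χ points} isListed of λ where
      (inj₁ e) → e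
      (inj₂ ())))

    hub-code : code χ (v ∷ points) ≡ hubCode
    hub-code = cong₂ _∷_
      (map-constant (χ v) points λ i → dec-true (R? _ _) (proj₁ (X-red (inside i))))
      points-code

    hub-unique : UniqueVec (v ∷ points)
    hub-unique = VecAll.lookup⁻ v≢points ∷ unique

    hub-inside : ∀ i → P (lookup (v ∷ points) i)
    hub-inside zero    = Pv
    hub-inside (suc i) = proj₂ (X-red (inside i))

    module _ {y} (Py : P y) (y≢v : y ≢ v) (¬Rvy : ¬ R v y) where
      row : Vec Bool 8
      row = Vec.map (χ y) points

      full-row : Vec.map (χ y) (v ∷ points) ≡ false ∷ row
      full-row = cong (_∷ row) (dec-false (R? y v) (¬Rvy ∘ R-sym))

      outside : ∀ i → y ≢ lookup (v ∷ points) i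
      outside zero    e = y≢v e
      outside (suc i) e = ¬Rvy (subst (R v) (sym e) (proj₁ (X-red (inside i))))

      y-code : code χ (y ∷ v ∷ points) ≡ (false ∷ row) ∷ hubCode
      y-code = cong₂ _∷_ full-row hub-code

      y-unique : UniqueVec (y ∷ v ∷ points)
      y-unique = VecAll.lookup⁻ outside ∷ hub-unique

      y-inside : ∀ i → P (lookup (y ∷ v ∷ points) i)
      y-inside zero    = Py
      y-inside (suc i) = hub-inside i

      row-class : ∃ λ i → inClass i row ≡ true
      row-class = case ∨-split (everyRow-sound (λ r → monochromatic ((false ∷ r) ∷ hubCode) ∨ classified r) rows-classified row) of λ where
        (inj₁ m) → contradiction (trans (cong monochromatic y-code) m) (not-monochromatic _ y-unique y-inside)
        (inj₂ c) → case ∨-split {inClass zero row} c of λ where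
          (inj₁ e) → zero , e
          (inj₂ c′) → case ∨-split {inClass (suc zero) row} c′ of λ where
            (inj₁ e) → suc zero , e
            (inj₂ e) → suc (suc zero) , e

    class-unique : ∀ {y z} (Py : P y) (y≢v : y ≢ v) (¬Rvy : ¬ R v y) (Pz : P z) (z≢v : z ≢ v) (¬Rvz : ¬ R v z) →
                   y ≢ z → ∀ i → inClass i (row Py y≢v ¬Rvy) ≡ true → inClass i (row Pz z≢v ¬Rvz) ≢ true
    class-unique {y} {z} Py y≢v ¬Rvy Pz z≢v ¬Rvz y≢z i ey ez =
      let m , m∈ , em = any-sound (λ m → row Py y≢v ¬Rvy == fromValue 8 m) (rowClass i) ey
          m′ , m′∈ , em′ = any-sound (λ m → row Pz z≢v ¬Rvz == fromValue 8 m) (rowClass i) ez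
          clashes = all-sound (λ m′ → twoRows true m m′ ∧ twoRows false m m′) {rowClass i}
                      (all-sound (λ m → all (λ m′ → twoRows true m m′ ∧ twoRows false m m′) (rowClass i)) {rowClass i}
                                 (classes-clash i) m∈)
                      m′∈
      in not-monochromatic (y ∷ z ∷ v ∷ points) yz-unique yz-inside
           (trans (cong monochromatic (cong₂ _∷_
                     (cong (χ y z ∷_) (trans (full-row Py y≢v ¬Rvy) (cong (false ∷_) (==-sound _ _ em))))
                     (trans (y-code Pz z≢v ¬Rvz) (cong (λ r → (false ∷ r) ∷ hubCode) (==-sound _ _ em′)))))
                  (bool-cases {χ y z} (λ e → twoRows e m m′) clashes))
      where
      yz-unique : UniqueVec (y ∷ z ∷ v ∷ points)
      yz-unique = (y≢z VecAll.∷ VecAll.lookup⁻ (outside Py y≢v ¬Rvy)) ∷ y-unique Pz z≢v ¬Rvz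

      yz-inside : ∀ i → P (lookup (y ∷ z ∷ v ∷ points) i)
      yz-inside zero    = Py
      yz-inside (suc i) = y-inside Pz z≢v ¬Rvz i

    -- By pigeonhole two of the four vertices share one of the three row classes, and then the edge
    -- between them completes a monochromatic wheel in either colour.
    at-most-three-others : (ys : Vec A 4) → UniqueVec ys → (∀ i → P (lookup ys i) × lookup ys i ≢ v × ¬ R v (lookup ys i)) → ⊥
    at-most-three-others ys ys-unique good =
      let i , j , i<j , same = Fin.pigeonhole (ℕ.n<1+n 3) (λ i → proj₁ (cls i))
      in class-unique (proj₁ (good i)) (proj₁ (proj₂ (good i))) (proj₂ (proj₂ (good i)))
                      (proj₁ (good j)) (proj₁ (proj₂ (good j))) (proj₂ (proj₂ (good j)))
                      (λ e → Fin.<⇒≢ i<j (lookup-injective ys-unique i j e))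
                      (proj₁ (cls i)) (proj₂ (cls i))
                      (subst (λ c → inClass c (row (proj₁ (good j)) (proj₁ (proj₂ (good j))) (proj₂ (proj₂ (good j)))) ≡ true)
                             (sym same) (proj₂ (cls j)))
      where
      cls : ∀ i → ∃ λ c → inClass c (row (proj₁ (good i)) (proj₁ (proj₂ (good i))) (proj₂ (proj₂ (good i)))) ≡ true
      cls i = row-class (proj₁ (good i)) (proj₁ (proj₂ (good i))) (proj₂ (proj₂ (good i)))

-- R(W₄, W₄) ≤ 15

∈-take⁻ : ∀ {A : Set} n {xs : List A} {x} → x ∈ take n xs → x ∈ xs
∈-take⁻ n {xs} x∈ = subst (_ ∈_) (List.take++drop≡id n xs) (∈-++⁺ˡ x∈)

length-take-≤ : ∀ {A : Set} n (xs : List A) → n ≤ length xs → length (take n xs) ≡ n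
length-take-≤ n xs n≤ = trans (List.length-take n xs) (ℕ.m≤n⇒m⊓n≡m n≤)

module _ {A : Set} {R : Rel A 0ℓ} (R? : ∀ x y → Dec (R x y)) where
  degree : List A → A → ℕ
  degree xs v = length (filter (R? v) xs)

  module _ (R-sym : ∀ {x y} → R x y → R y x) where
    -- The vertex `a` adds one to the degree of each vertex adjacent to it, and by symmetry the
    -- degree of `a` counts these vertices.
    degree-sum-∷ : ∀ a xs ys → sum (map (degree (a ∷ ys)) xs) ≡ degree xs a + sum (map (degree ys) xs)
    degree-sum-∷ a []       ys = refl
    degree-sum-∷ a (x ∷ xs) ys with R? x a | R? a x
    ... | yes _ | yes _ rewrite degree-sum-∷ a xs ys = cong suc (exchange (degree ys x) (degree xs a) _)
      where
      exchange : ∀ p q r → p + (q + r) ≡ q + (p + r)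
      exchange = solve-∀
    ... | no _  | no _  rewrite degree-sum-∷ a xs ys = exchange (degree ys x) (degree xs a) _
      where
      exchange : ∀ p q r → p + (q + r) ≡ q + (p + r)
      exchange = solve-∀
    ... | yes r | no ¬r = contradiction (R-sym r) ¬r
    ... | no ¬r | yes r = contradiction (R-sym r) ¬r

    handshake : (∀ {x} → ¬ R x x) → ∀ xs → ∃ λ e → sum (map (degree xs) xs) ≡ 2 * e
    handshake R-irr [] = 0 , refl
    handshake R-irr (a ∷ xs) =
      let e , eq = handshake R-irr xs
      in degree xs a + e , (begin
        degree (a ∷ xs) a + sum (map (degree (a ∷ xs)) xs)
          ≡⟨ cong₂ _+_ (cong length (List.filter-reject (R? a) R-irr)) (degree-sum-∷ a xs xs) ⟩
        degree xs a + (degree xs a + sum (map (degree xs) xs))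
          ≡⟨ cong (λ s → degree xs a + (degree xs a + s)) eq ⟩
        degree xs a + (degree xs a + 2 * e)
          ≡⟨ double (degree xs a) e ⟩
        2 * (degree xs a + e) ∎)
      where
      open ≡-Reasoning
      double : ∀ d e → d + (d + 2 * e) ≡ 2 * (d + e)
      double = solve-∀

sum-constant : ∀ {A : Set} (f : A → ℕ) k xs → (∀ {x} → x ∈ xs → f x ≡ k) → sum (map f xs) ≡ length xs * k
sum-constant f k []       e = refl
sum-constant f k (x ∷ xs) e = cong₂ _+_ (e (here refl)) (sum-constant f k xs (e ∘ there))

filter-two : ∀ {A : Set} {P Q : Pred A 0ℓ} (P? : U.Decidable P) (Q? : U.Decidable Q) xs →
             (∀ {x} → x ∈ xs → P x ⊎ Q x) → (∀ {x} → P x → ¬ Q x) →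
             length (filter P? xs) + length (filter Q? xs) ≡ length xs
filter-two P? Q? [] total excl = refl
filter-two P? Q? (x ∷ xs) total excl with P? x | Q? x | filter-two P? Q? xs (total ∘ there) excl
... | yes p | yes q | _  = contradiction q (excl p)
... | yes p | no ¬q | ih = cong suc ih
... | no ¬p | yes q | ih = trans (ℕ.+-suc _ _) (cong suc ih)
... | no ¬p | no ¬q | _  = case total (here refl) of λ where
  (inj₁ p) → contradiction p ¬p
  (inj₂ q) → contradiction q ¬q

degrees-sum : ∀ {A : Set} {R B : Rel A 0ℓ} (R? : ∀ x y → Dec (R x y)) (B? : ∀ x y → Dec (B x y)) →
              (∀ {x} → ¬ R x x) → (∀ {x} → ¬ B x x) → (∀ {x y} → R x y → ¬ B x y) →
              ∀ {xs v} → Unique xs → (∀ {x} → x ∈ xs → v ≢ x → R v x ⊎ B v x) → v ∈ xs →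
              suc (degree R? xs v + degree B? xs v) ≡ length xs
degrees-sum R? B? R-irr B-irr excl {a ∷ xs} (a∉xs ∷ uni) total (here refl)
  rewrite List.filter-reject (R? a) {xs = xs} (R-irr {a}) | List.filter-reject (B? a) {xs = xs} (B-irr {a}) =
  cong suc (filter-two (R? a) (B? a) xs (λ x∈ → total (there x∈) (All.lookup a∉xs x∈)) excl)
degrees-sum R? B? R-irr B-irr excl {a ∷ xs} {v} (a∉xs ∷ uni) total (there v∈xs)
  with R? v a | B? v a | degrees-sum R? B? R-irr B-irr excl {xs} {v} uni (total ∘ there) v∈xs
... | yes r | yes b | _  = contradiction b (excl r)
... | yes r | no _  | ih = cong suc ih
... | no _  | yes b | ih = cong suc (trans (ℕ.+-suc _ _) ih)
... | no ¬r | no ¬b | _  = case total (here refl) (λ e → All.lookup a∉xs v∈xs (sym e)) of λ where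
  (inj₁ r) → contradiction r ¬r
  (inj₂ b) → contradiction b ¬b

at-least-four : ∀ {A : Set} {ys : List A} → 4 ≤ length ys → Unique ys →
                Σ (Vec.Vec A 4) λ zs → UniqueVec zs × (∀ i → Vec.lookup zs i ∈ ys)
at-least-four {ys = a ∷ b ∷ c ∷ d ∷ _} _ ((ab ∷ ac ∷ ad ∷ _) ∷ (bc ∷ bd ∷ _) ∷ (cd ∷ _) ∷ _) =
  a ∷ b ∷ c ∷ d ∷ [] ,
  (ab ∷ ac ∷ ad ∷ []) ∷ (bc ∷ bd ∷ []) ∷
    (cd ∷ []) ∷ [] ∷ [] ,
  λ { zero → here refl ; (suc zero) → there (here refl) ; (suc (suc zero)) → there (there (here refl))
    ; (suc (suc (suc zero))) → there (there (there (here refl))) }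
at-least-four {ys = []} ()
at-least-four {ys = _ ∷ []} (s≤s ())
at-least-four {ys = _ ∷ _ ∷ []} (s≤s (s≤s ()))
at-least-four {ys = _ ∷ _ ∷ _ ∷ []} (s≤s (s≤s (s≤s ())))

module Degrees {A : Set} {R B : Rel A 0ℓ} {xs : List A} (unique : Unique xs)
         (red : TwoColoured R B (_∈ xs)) (blue : TwoColoured B R (_∈ xs)) (excl : ∀ {x y} → R x y → ¬ B x y)
         (noR : ¬ W4 _≢_ R (_∈ xs)) (noB : ¬ W4 _≢_ B (_∈ xs)) where
  open TwoColoured red
  open TwoColoured blue using () renaming (R? to B?; R-irr to B-irr)

  degrees : ∀ {v} → v ∈ xs → suc (degree R? xs v + degree B? xs v) ≡ length xs
  degrees v∈xs = degrees-sum R? B? R-irr B-irr excl unique (total v∈xs) v∈xs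

  degree≤8 : ∀ {v} → v ∈ xs → degree R? xs v ≤ 8
  degree≤8 {v} v∈xs = ℕ.≮⇒≥ λ 9≤d →
    degree≢9 red noR noB v∈xs (Unique.take⁺ 9 (Unique.filter⁺ (R? v) unique))
      (λ x∈ → let p , q = ∈-filter⁻ (R? v) (∈-take⁻ 9 x∈) in q , p)
      (length-take-≤ 9 (filter (R? v) xs) 9≤d)

  -- Of the fourteen edges at `v` at most eight are red. If eight are red, at least six are blue,
  -- and four blue neighbours already contradict `at-most-three-others`.
  degree≤7 : length xs ≡ 15 → ∀ {v} → v ∈ xs → degree R? xs v ≤ 7
  degree≤7 l {v} v∈xs = ℕ.≮⇒≥ λ 8≤d →
    let zs , zs-unique , zs⊆ = at-least-four
          (ℕ.≤-trans (s≤s (s≤s (s≤s (s≤s z≤n)))) (ℕ.+-cancelˡ-≤ 8 6 (degree B? xs v) (begin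
            14                              ≡⟨ ℕ.suc-injective (trans (sym l) (sym (degrees v∈xs))) ⟩
            degree R? xs v + degree B? xs v ≤⟨ ℕ.+-monoˡ-≤ _ (degree≤8 v∈xs) ⟩
            8 + degree B? xs v              ∎)))
          (Unique.filter⁺ (B? v) unique)
    in at-most-three-others red noR noB v∈xs (Unique.take⁺ 8 (Unique.filter⁺ (R? v) unique))
         (λ x∈ → let p , q = ∈-filter⁻ (R? v) (∈-take⁻ 8 x∈) in q , p)
         (length-take-≤ 8 (filter (R? v) xs) 8≤d)
         zs zs-unique
         (λ i → let p , q = ∈-filter⁻ (B? v) (zs⊆ i)
                in p , (λ e → B-irr (subst (B v) e q)) , λ r → excl r q)
    where open ℕ.≤-Reasoning

module _ {A : Set} {R B : Rel A 0ℓ} {xs : List A} (unique : Unique xs)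
         (red : TwoColoured R B (_∈ xs)) (blue : TwoColoured B R (_∈ xs)) (excl : ∀ {x y} → R x y → ¬ B x y)
         (noR : ¬ W4 _≢_ R (_∈ xs)) (noB : ¬ W4 _≢_ B (_∈ xs)) where
  open TwoColoured red

  -- The red and the blue degree are at most seven and add up to fourteen, so red would be 7-regular
  -- on 15 vertices, with the odd degree sum 105.
  ramsey-W4-W4 : length xs ≢ 15
  ramsey-W4-W4 l =
    let e , eq = handshake R? R-sym R-irr xs
    in from-no (2 ∣? 105) (divides e (begin
         105                          ≡⟨ cong (λ n → n * 7) l ⟨
         length xs * 7                ≡⟨ sum-constant (degree R? xs) 7 xs degree≡7 ⟨
         sum (map (degree R? xs) xs)  ≡⟨ eq ⟩
         2 * e                        ≡⟨ ℕ.*-comm 2 e ⟩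
         e * 2                        ∎))
    where
    open ≡-Reasoning
    open TwoColoured blue using () renaming (R? to B?)

    degree≡7 : ∀ {v} → v ∈ xs → degree R? xs v ≡ 7
    degree≡7 {v} v∈xs = ℕ.≤-antisym (Degrees.degree≤7 unique red blue excl noR noB l v∈xs)
      (ℕ.+-cancelʳ-≤ 7 7 _ (ℕ.≤-trans
        (ℕ.≤-reflexive (ℕ.suc-injective (trans (sym l) (sym (Degrees.degrees unique red blue excl noR noB v∈xs)))))
        (ℕ.+-monoʳ-≤ (degree R? xs v)
          (Degrees.degree≤7 unique blue red (λ b r → excl r b) noB noR l v∈xs))))

-- Gallai's theorem

search : ∀ {A : Set} {P : Pred A 0ℓ} → U.Decidable P → ∀ xs → (∃ λ x → x ∈ xs × P x) ⊎ (∀ {x} → x ∈ xs → ¬ P x)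
search P? xs with any? P? xs
... | yes some = inj₁ (find some)
... | no none  = inj₂ λ x∈xs px → none (lose x∈xs px)

filter-↭ : ∀ {A : Set} {P : Pred A 0ℓ} (P? : U.Decidable P) xs → xs ↭ filter P? xs ++ filter (¬? ∘ P?) xs
filter-↭ P? []       = ↭-refl
filter-↭ P? (x ∷ xs) with P? x
... | yes _ = prep x (filter-↭ P? xs)
... | no  _ = ↭-trans (prep x (filter-↭ P? xs)) (↭-sym (shift x (filter P? xs) (filter (¬? ∘ P?) xs)))

Inhabited : ∀ {A : Set} → List A → Set
Inhabited xs = ∃ λ x → x ∈ xs

-- The diagonal carries arbitrary colours, so an edge has to exclude it explicitly.
Coloured : ∀ {V : Set} {k} → (V → V → Fin k) → Fin k → Rel V 0ℓ
Coloured col i x y = x ≢ y × col x y ≡ i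

module GallaiColoured {V : Set} (_≟_ : B.DecidableEquality V) {k} (col : V → V → Fin k) (col-sym : ∀ x y → col x y ≡ col y x)
  (gallai : ∀ {x y z} → x ≢ y → y ≢ z → x ≢ z → col x y ≡ col y z ⊎ col y z ≡ col x z ⊎ col x y ≡ col x z) where

  E : Fin k → Rel V 0ℓ
  E = Coloured col

  E? : ∀ i x y → Dec (E i x y)
  E? i x y = ¬? (x ≟ y) ×-dec (col x y Fin.≟ i)

  E-sym : ∀ {i x y} → E i x y → E i y x
  E-sym (x≢y , e) = x≢y ∘ sym , trans (col-sym _ _) e

  E-irr : ∀ {i x} → ¬ E i x x
  E-irr (x≢x , _) = x≢x refl

  E-unique : ∀ {i j x y} → E i x y → E j x y → i ≡ j
  E-unique (_ , e) (_ , e′) = trans (sym e) e′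

  triangle : ∀ {i j x y z} → i ≢ j → E i x y → E j y z → E i x z ⊎ E j x z
  triangle {x = x} {z = z} i≢j xy@(x≢y , eᵢ) yz@(y≢z , eⱼ) with x ≟ z
  ... | yes refl = contradiction (E-unique (E-sym xy) yz) i≢j
  ... | no x≢z with gallai x≢y y≢z x≢z
  ...   | inj₁ e        = contradiction (trans (sym eᵢ) (trans e eⱼ)) i≢j
  ...   | inj₂ (inj₁ e) = inj₂ (x≢z , trans (sym e) eⱼ)
  ...   | inj₂ (inj₂ e) = inj₁ (x≢z , trans (sym e) eᵢ)

  meet : ∀ {i j l x y} → j ≢ l → E i x y ⊎ E j x y → E i x y ⊎ E l x y → E i x y
  meet j≢l (inj₁ e) _        = e
  meet j≢l (inj₂ _) (inj₁ e) = e
  meet j≢l (inj₂ e) (inj₂ f) = contradiction (E-unique e f) j≢l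

  Either : Fin k → Fin k → Rel V 0ℓ
  Either r b x y = E r x y ⊎ E b x y

  Either? : ∀ r b x y → Dec (Either r b x y)
  Either? r b x y = E? r x y ⊎-dec E? b x y

  Either-sym : ∀ {r b x y} → Either r b x y → Either r b y x
  Either-sym = Sum.map E-sym E-sym

  Between : Rel V 0ℓ → List V → List V → Set
  Between R S T = ∀ {x y} → x ∈ S → y ∈ T → R x y

  -- This is much less than a Gallai partition, but it can be maintained while vertices are added
  -- one at a time. The modules are recovered later from minimal sides.
  record Cut (r b : Fin k) (xs : List V) : Set where
    field
      {S T} : List V
      parts : xs ↭ S ++ T
      inS   : Inhabited S
      inT   : Inhabited T
      cross : Between (Either r b) S T

  Cut-swap : ∀ {r b xs} → Cut r b xs → Cut b r xs
  Cut-swap cut = record { parts = parts ; inS = inS ; inT = inT ; cross = λ s t → swap (cross s t) }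
    where open Cut cut

  Cut-↭ : ∀ {r b xs ys} → xs ↭ ys → Cut r b ys → Cut r b xs
  Cut-↭ p cut = record { parts = ↭-trans p parts ; inS = inS ; inT = inT ; cross = cross }
    where open Cut cut

  singleton-cut : ∀ {r b v xs} → Inhabited xs → (∀ {x} → x ∈ xs → Either r b v x) → Cut r b (v ∷ xs)
  singleton-cut ne e = record
    { parts = ↭-refl ; inS = _ , here refl ; inT = ne ; cross = λ { (here refl) y∈ → e y∈ ; (there ()) _ } }

  filter-cut : ∀ {P : Pred V 0ℓ} (P? : U.Decidable P) {r b xs} → (∃ λ x → x ∈ xs × P x) → (∃ λ x → x ∈ xs × ¬ P x) →
               (∀ {x y} → x ∈ xs → y ∈ xs → P x → ¬ P y → Either r b x y) → Cut r b xs
  filter-cut P? {xs = xs} (x , x∈ , px) (y , y∈ , ¬py) e = record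
    { parts = filter-↭ P? xs
    ; inS = x , ∈-filter⁺ P? x∈ px
    ; inT = y , ∈-filter⁺ (¬? ∘ P?) y∈ ¬py
    ; cross = λ s t → let s∈ , ps = ∈-filter⁻ P? s ; t∈ , ¬pt = ∈-filter⁻ (¬? ∘ P?) t in e s∈ t∈ ps ¬pt
    }

  module AddVertex {r b} (r≢b : r ≢ b) {v xs} (cut : Cut r b xs)
    {s₀ t₀ g} (s₀∈S : s₀ ∈ Cut.S cut) (t₀∈T : t₀ ∈ Cut.T cut) (g≢r : g ≢ r) (g≢b : g ≢ b)
    (vs₀ : E g v s₀) (vt₀ : E g v t₀) where
    open Cut cut

    not-g : ∀ {x y} → Either r b x y → ¬ E g x y
    not-g (inj₁ e) f = g≢r (E-unique f e)
    not-g (inj₂ e) f = g≢b (E-unique f e)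

    side : ∀ {x} → x ∈ xs → x ∈ S ⊎ x ∈ T
    side x∈xs = ∈-++⁻ S (∈-resp-↭ parts x∈xs)

    palette : ∀ {x} → x ∈ xs → E g v x ⊎ Either r b v x
    palette x∈xs with side x∈xs
    ... | inj₁ x∈S = case cross x∈S t₀∈T of λ where
      (inj₁ e) → Sum.map₂ inj₁ (triangle g≢r vt₀ (E-sym e))
      (inj₂ e) → Sum.map₂ inj₂ (triangle g≢b vt₀ (E-sym e))
    ... | inj₂ x∈T = case cross s₀∈S x∈T of λ where
      (inj₁ e) → Sum.map₂ inj₁ (triangle g≢r vs₀ e)
      (inj₂ e) → Sum.map₂ inj₂ (triangle g≢b vs₀ e)

    -- An edge of colour g from a j-neighbour of v to a g-neighbour of v is the only thing that can
    -- spoil the cut between the j-neighbours of v and all other vertices.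
    Obstacle : Fin k → Pred V 0ℓ
    Obstacle j x = E j v x × Any (λ y → E g v y × E g x y) xs

    Obstacle? : ∀ j → U.Decidable (Obstacle j)
    Obstacle? j x = E? j v x ×-dec any? (λ y → E? g v y ×-dec E? g x y) xs

    -- The p-neighbours of v form one side. Towards a q-neighbour the triangle with v leaves p and
    -- q; towards a g-neighbour it leaves p and g, and g would be an obstacle. Without any
    -- p-neighbour, v alone is a side, in the colours g and q.
    no-obstacle : ∀ {p q} → p ≢ q → g ≢ p → (∀ {x} → x ∈ xs → E g v x ⊎ Either p q v x) →
                  (∀ {x} → x ∈ xs → ¬ Obstacle p x) →
                  Cut p q (v ∷ xs) ⊎ Cut g q (v ∷ xs)
    no-obstacle {p} {q} p≢q g≢p palette′ none with search (E? p v) xs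
    ... | inj₂ no-p = inj₂ (singleton-cut (s₀ , ∈-resp-↭ (↭-sym parts) (∈-++⁺ˡ s₀∈S)) λ x∈ → case palette′ x∈ of λ where
      (inj₁ e)        → inj₁ e
      (inj₂ (inj₁ e)) → contradiction e (no-p x∈)
      (inj₂ (inj₂ e)) → inj₂ e)
    ... | inj₁ (x₀ , x₀∈ , vx₀) = inj₁ (filter-cut (E? p v) (x₀ , there x₀∈ , vx₀) (v , here refl , E-irr) separated)
      where
      separated : ∀ {x y} → x ∈ v ∷ xs → y ∈ v ∷ xs → E p v x → ¬ E p v y → Either p q x y
      separated (here refl) _          vx _   = contradiction vx E-irr
      separated (there _) (here refl)  vx _   = inj₁ (E-sym vx)
      separated (there x∈) (there y∈)  vx ¬vy with palette′ y∈
      ... | inj₂ (inj₁ e) = contradiction e ¬vy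
      ... | inj₂ (inj₂ e) = triangle p≢q (E-sym vx) e
      ... | inj₁ e with triangle (g≢p ∘ sym) (E-sym vx) e
      ...   | inj₁ f = inj₁ f
      ...   | inj₂ f = contradiction (vx , lose y∈ (e , f)) (none x∈)

    same-side : ∀ {x y} → x ∈ xs → y ∈ xs → E g x y → (x ∈ S × y ∈ S) ⊎ (x ∈ T × y ∈ T)
    same-side x∈ y∈ xy with side x∈ | side y∈
    ... | inj₁ x∈S | inj₁ y∈S = inj₁ (x∈S , y∈S)
    ... | inj₂ x∈T | inj₂ y∈T = inj₂ (x∈T , y∈T)
    ... | inj₁ x∈S | inj₂ y∈T = contradiction xy (not-g (cross x∈S y∈T))
    ... | inj₂ x∈T | inj₁ y∈S = contradiction (E-sym xy) (not-g (cross y∈S x∈T))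

    -- The triangle v, x, w leaves j or g for the edge x w, and then the triangle x, y, w leaves g
    -- or j for y w. Both edges are coloured r or b, which excludes g.
    through : ∀ {j x y w} → g ≢ j → E j v x → E g x y → E g v w → Either r b x w → Either r b y w → E j x w × E j y w
    through g≢j vx xy vw xw yw =
      let e = case triangle (g≢j ∘ sym) (E-sym vx) vw of λ where
                (inj₁ e) → e
                (inj₂ e) → contradiction e (not-g xw)
          f = case triangle g≢j (E-sym xy) e of λ where
                (inj₁ f) → contradiction f (not-g yw)
                (inj₂ f) → f
      in e , f

    -- The edge y y′ lies in three triangles whose other colours leave it {r, b}, {b, g} and {r, g}.
    clashing : ∀ {x y x′ y′} → E b v x → E g v y → E g x y → E r v x′ → E g v y′ → E g x′ y′ →
               Either r b x y′ → Either r b x′ y → ¬ Either r b y y′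
    clashing vx vy xy vx′ vy′ x′y′ xy′ x′y yy′ = contradiction yy′ λ where
        (inj₁ e) → [ (λ f → g≢r (E-unique f e)) , (λ f → r≢b (E-unique e f)) ]′ (triangle g≢b (E-sym xy) b-xy′)
        (inj₂ e) → [ (λ f → r≢b (E-unique f e)) , (λ f → g≢b (E-unique f e)) ]′ (triangle (g≢r ∘ sym) (E-sym r-x′y) x′y′)
      where
      b-xy′ : E b _ _
      b-xy′ = meet (g≢r ∘ sym) (swap xy′) (triangle (g≢b ∘ sym) (E-sym vx) vy′)

      r-x′y : E r _ _
      r-x′y = meet (g≢b ∘ sym) x′y (triangle (g≢r ∘ sym) (E-sym vx′) vy)

    -- For obstacles on opposite sides the cut supplies the edges coloured r or b that `clashing`
    -- wants. On the same side, `t₀` or `s₀` across the cut sees one obstacle in b and the other in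
    -- r by `through`, and triangles with it supply those edges.
    not-both : ∀ {x y x′ y′} → x ∈ xs → y ∈ xs → x′ ∈ xs → y′ ∈ xs →
               E b v x → E g v y → E g x y → E r v x′ → E g v y′ → E g x′ y′ → ⊥
    not-both x∈ y∈ x′∈ y′∈ vx vy xy vx′ vy′ x′y′
      with same-side x∈ y∈ xy | same-side x′∈ y′∈ x′y′
    ... | inj₁ (xS , yS) | inj₂ (x′T , y′T) =
      clashing vx vy xy vx′ vy′ x′y′ (cross xS y′T) (Either-sym (cross yS x′T)) (cross yS y′T)
    ... | inj₂ (xT , yT) | inj₁ (x′S , y′S) =
      clashing vx vy xy vx′ vy′ x′y′ (Either-sym (cross y′S xT)) (cross x′S yT) (Either-sym (cross y′S yT))
    ... | inj₁ (xS , yS) | inj₁ (x′S , y′S) =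
      let xt , yt   = through g≢b vx xy vt₀ (cross xS t₀∈T) (cross yS t₀∈T)
          x′t , y′t = through g≢r vx′ x′y′ vt₀ (cross x′S t₀∈T) (cross y′S t₀∈T)
      in clashing vx vy xy vx′ vy′ x′y′ (swap (triangle (r≢b ∘ sym) xt (E-sym y′t)))
           (triangle r≢b x′t (E-sym yt)) (swap (triangle (r≢b ∘ sym) yt (E-sym y′t)))
    ... | inj₂ (xT , yT) | inj₂ (x′T , y′T) =
      let xs , ys   = through g≢b vx xy vs₀ (Either-sym (cross s₀∈S xT)) (Either-sym (cross s₀∈S yT))
          x′s , y′s = through g≢r vx′ x′y′ vs₀ (Either-sym (cross s₀∈S x′T)) (Either-sym (cross s₀∈S y′T))
      in clashing vx vy xy vx′ vy′ x′y′ (swap (triangle (r≢b ∘ sym) xs (E-sym y′s)))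
           (triangle r≢b x′s (E-sym ys)) (swap (triangle (r≢b ∘ sym) ys (E-sym y′s)))

    add : ∃₂ λ p q → p ≢ q × Cut p q (v ∷ xs)
    add with search (Obstacle? b) xs | search (Obstacle? r) xs
    ... | inj₂ none | _ = case no-obstacle (r≢b ∘ sym) g≢b (Sum.map₂ swap ∘ palette) none of λ where
      (inj₁ c) → b , r , r≢b ∘ sym , c
      (inj₂ c) → g , r , g≢r , c
    ... | _ | inj₂ none = case no-obstacle r≢b g≢r palette none of λ where
      (inj₁ c) → r , b , r≢b , c
      (inj₂ c) → g , b , g≢b , c
    ... | inj₁ (x , x∈ , vx , some) | inj₁ (x′ , x′∈ , vx′ , some′) =
      let y , y∈ , vy , xy = find some
          y′ , y′∈ , vy′ , x′y′ = find some′
      in ⊥-elim (not-both x∈ y∈ x′∈ y′∈ vx vy xy vx′ vy′ x′y′)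

  -- If `v` sees one side in r and b only, it joins the other side. Otherwise it sends an edge of a
  -- third colour to each side, and the edge across the cut between their ends forces these two
  -- colours to agree.
  add-vertex : ∀ {r b} → r ≢ b → ∀ {v xs} → (∀ {x} → x ∈ xs → v ≢ x) → Cut r b xs → ∃₂ λ p q → p ≢ q × Cut p q (v ∷ xs)
  add-vertex {r} {b} r≢b {v} {xs} v∉xs cut
    with search (λ x → ¬? (Either? r b v x)) (Cut.S cut) | search (λ x → ¬? (Either? r b v x)) (Cut.T cut)
  ... | inj₂ all-S | _ = r , b , r≢b , record
      { S = S ; T = v ∷ T
      ; parts = ↭-trans (prep v parts) (↭-sym (shift v S T)) ; inS = inS ; inT = v , here refl
      ; cross = λ { s (here refl) → Either-sym (decidable-stable (Either? r b v _) (all-S s)) ; s (there t) → cross s t } }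
    where open Cut cut
  ... | _ | inj₂ all-T = r , b , r≢b , record
      { S = v ∷ S ; T = T
      ; parts = prep v parts ; inS = v , here refl ; inT = inT
      ; cross = λ { (here refl) t → decidable-stable (Either? r b v _) (all-T t) ; (there s) t → cross s t } }
    where open Cut cut
  ... | inj₁ (s₀ , s₀∈S , ¬vs₀) | inj₁ (t₀ , t₀∈T , ¬vt₀) =
    AddVertex.add r≢b cut s₀∈S t₀∈T
      (λ e → ¬vs₀ (inj₁ (v≢s₀ , e))) (λ e → ¬vs₀ (inj₂ (v≢s₀ , e))) (v≢s₀ , refl)
      (case cross s₀∈S t₀∈T of λ where
        (inj₁ e) → case triangle (λ e → ¬vs₀ (inj₁ (v≢s₀ , e))) (v≢s₀ , refl) e of λ where
          (inj₁ f) → f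
          (inj₂ f) → contradiction (inj₁ f) ¬vt₀
        (inj₂ e) → case triangle (λ e → ¬vs₀ (inj₂ (v≢s₀ , e))) (v≢s₀ , refl) e of λ where
          (inj₁ f) → f
          (inj₂ f) → contradiction (inj₂ f) ¬vt₀)
    where
    open Cut cut
    v≢s₀ : v ≢ s₀
    v≢s₀ = v∉xs (∈-resp-↭ (↭-sym parts) (∈-++⁺ˡ s₀∈S))

  -- The induction adds one vertex at a time. The colours i, j are there for the base case: a pair
  -- of vertices shows one colour, and a cut names two.
  gallai-cut : ∀ {i j : Fin k} → i ≢ j → ∀ {xs} → Unique xs → 2 ≤ length xs → ∃₂ λ r b → r ≢ b × Cut r b xs
  gallai-cut i≢j {_ ∷ []} _ (s≤s ())
  gallai-cut {i} {j} i≢j {x ∷ y ∷ []} ((x≢y ∷ []) ∷ _) _ with col x y Fin.≟ i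
  ... | yes e = i , j , i≢j , singleton-cut (y , here refl) λ { (here refl) → inj₁ (x≢y , e) ; (there ()) }
  ... | no ¬e = col x y , i , ¬e , singleton-cut (y , here refl) λ { (here refl) → inj₁ (x≢y , refl) ; (there ()) }
  gallai-cut i≢j {x ∷ xs@(_ ∷ _ ∷ _)} (x∉ ∷ unique) _ =
    let r , b , r≢b , cut = gallai-cut i≢j unique (s≤s (s≤s z≤n))
    in add-vertex r≢b (All.lookup x∉) cut

-- The upper bound

-- Three vertices on which every colour is a matching form a rainbow triangle, hence 2. Four
-- vertices in one colour are too few for W₄, hence 4. Next come R(W₄, W₄) - 1 = 14 and two copies
-- of 14 joined in a third colour.
extremal : ℕ → ℕ
extremal 0                           = 2
extremal 1                           = 4
extremal 2                           = 14
extremal 3                           = 28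
extremal (suc (suc n@(suc (suc _)))) = 5 * extremal n

extremal-double : ∀ n → 2 * extremal n ≤ extremal (suc n)
extremal-double 0 = ℕ.≤-refl
extremal-double 1 = ℕ.m≤m+n 8 6
extremal-double 2 = ℕ.≤-refl
extremal-double 3 = ℕ.m≤m+n 56 14
extremal-double (suc (suc n@(suc (suc _)))) = begin
  2 * (5 * extremal n) ≡⟨ exchange (extremal n) ⟩
  5 * (2 * extremal n) ≤⟨ ℕ.*-monoʳ-≤ 5 (extremal-double n) ⟩
  5 * extremal (suc n) ∎
  where
  open ℕ.≤-Reasoning
  exchange : ∀ m → 2 * (5 * m) ≡ 5 * (2 * m)
  exchange = solve-∀

-- Pays for a block together with two pieces on either side of it, each with two active colours
-- fewer. Likewise `extremal-double` pays for two parts with one active colour fewer.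
extremal-quintuple : ∀ n → 5 * extremal n ≤ extremal (2 + n)
extremal-quintuple 0             = ℕ.m≤m+n 10 4
extremal-quintuple 1             = ℕ.m≤m+n 20 8
extremal-quintuple (suc (suc n)) = ℕ.≤-refl

extremal-linear : ∀ n → 2 + n ≤ extremal n
extremal-linear zero    = ℕ.≤-refl
extremal-linear (suc n) = begin
  1 + (2 + n)                 ≤⟨ ℕ.+-mono-≤ (ℕ.≤-trans (s≤s z≤n) (extremal-linear n)) (extremal-linear n) ⟩
  extremal n + extremal n     ≡⟨ cong (extremal n +_) (ℕ.+-identityʳ _) ⟨
  2 * extremal n              ≤⟨ extremal-double n ⟩
  extremal (suc n)            ∎
  where open ℕ.≤-Reasoning

-- Needed when one vertex is joined to all others in a C₄-free colour: that colour becomes a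
-- matching, and both the vertex and the lost unit of c must be paid for.
extremal-step : ∀ n → 2 + extremal n ≤ extremal (suc n)
extremal-step n = begin
  2 + extremal n              ≤⟨ ℕ.+-monoˡ-≤ _ (ℕ.≤-trans (ℕ.m≤m+n 2 n) (extremal-linear n)) ⟩
  extremal n + extremal n     ≡⟨ cong (extremal n +_) (ℕ.+-identityʳ _) ⟨
  2 * extremal n              ≤⟨ extremal-double n ⟩
  extremal (suc n)            ∎
  where open ℕ.≤-Reasoning

extremal-fourteen : ∀ n → 14 + n ≤ extremal (2 + n)
extremal-fourteen zero    = ℕ.≤-refl
extremal-fourteen (suc n) = ℕ.≤-trans (ℕ.≤-trans (s≤s (extremal-fourteen n)) (ℕ.n≤1+n _)) (extremal-step (2 + n))

-- States of the colours and their weights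

-- A colour in state `matching` may still occur on disjoint edges. It stays in the vector and merely
-- stops counting as active, which is why f(0) is 2 and not 1.
data State : Set where
  full c4 matching : State

active squareFree : State → ℕ
active full     = 1
active c4       = 1
active matching = 0
squareFree full     = 0
squareFree c4       = 1
squareFree matching = 0

weight : ∀ {k} → (State → ℕ) → Vec State k → ℕ
weight w σ = Vec.sum (Vec.map w σ)

weight-update : ∀ {k} w (σ : Vec State k) i s → weight w (σ [ i ]≔ s) + w (lookup σ i) ≡ weight w σ + w s
weight-update w (t ∷ σ) zero    s = rotate (w s) (weight w σ) (w t)
  where
  rotate : ∀ x y z → x + y + z ≡ z + y + x
  rotate = solve-∀
weight-update w (t ∷ σ) (suc i) s =
  trans (ℕ.+-assoc (w t) _ _) (trans (cong (w t +_) (weight-update w σ i s)) (sym (ℕ.+-assoc (w t) _ _)))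

weight-replace : ∀ {k} w (σ : Vec State k) {i t} s → lookup σ i ≡ t → weight w (σ [ i ]≔ s) + w t ≡ weight w σ + w s
weight-replace w σ {i} s refl = weight-update w σ i s

weight-matching : ∀ {w} k → w matching ≡ 0 → weight w (Vec.replicate k matching) ≡ 0
weight-matching zero    e = refl
weight-matching (suc k) e = cong₂ _+_ e (weight-matching k e)

squareFree≤active : ∀ {k} (σ : Vec State k) → weight squareFree σ ≤ weight active σ
squareFree≤active []             = z≤n
squareFree≤active (full     ∷ σ) = ℕ.m≤n⇒m≤1+n (squareFree≤active σ)
squareFree≤active (c4       ∷ σ) = s≤s (squareFree≤active σ)
squareFree≤active (matching ∷ σ) = squareFree≤active σ

active-drop : ∀ {k} (τ : Vec State k) i → lookup τ i ≢ matching →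
              suc (weight active (τ [ i ]≔ matching)) ≡ weight active τ
active-drop τ i ≢m = go (lookup τ i) refl
  where
  go : ∀ s → lookup τ i ≡ s → suc (weight active (τ [ i ]≔ matching)) ≡ weight active τ
  go full     e = trans (ℕ.+-comm 1 _) (trans (weight-replace active τ matching e) (ℕ.+-identityʳ _))
  go c4       e = trans (ℕ.+-comm 1 _) (trans (weight-replace active τ matching e) (ℕ.+-identityʳ _))
  go matching e = contradiction e ≢m

squareFree-drop : ∀ {k} (τ : Vec State k) i → lookup τ i ≡ full →
                  weight squareFree (τ [ i ]≔ matching) ≡ weight squareFree τ
squareFree-drop τ i e =
  trans (sym (ℕ.+-identityʳ _)) (trans (weight-replace squareFree τ matching e) (ℕ.+-identityʳ _))

c4-drop : ∀ {k} (τ : Vec State k) i → lookup τ i ≡ c4 →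
          suc (weight squareFree (τ [ i ]≔ matching)) ≡ weight squareFree τ
c4-drop τ i e = trans (ℕ.+-comm 1 _) (trans (weight-replace squareFree τ matching e) (ℕ.+-identityʳ _))

full→c4 : ∀ {k} (τ : Vec State k) i → lookup τ i ≡ full → weight squareFree (τ [ i ]≔ c4) ≡ suc (weight squareFree τ) ×
          weight active (τ [ i ]≔ c4) ≡ weight active τ
full→c4 τ i e =
  trans (sym (ℕ.+-identityʳ _)) (trans (weight-replace squareFree τ c4 e) (ℕ.+-comm _ 1)) ,
  ℕ.+-cancelʳ-≡ 1 _ _ (weight-replace active τ c4 e)

full≢ : ∀ {s} → s ≡ full → s ≢ matching
full≢ refl ()

c4≢ : ∀ {s} → s ≡ c4 → s ≢ matching
c4≢ refl ()

Unique-++⁻ : ∀ {A : Set} (xs : List A) {ys} → Unique (xs ++ ys) → Unique xs × Unique ys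
Unique-++⁻ []       u        = [] , u
Unique-++⁻ (x ∷ xs) (x∉ ∷ u) = let uxs , uys = Unique-++⁻ xs u in All.++⁻ˡ xs x∉ ∷ uxs , uys

two-of : ∀ {A : Set} {xs : List A} → Unique xs → 2 ≤ length xs → Two _≢_ (_∈ xs)
two-of {xs = a ∷ c ∷ _} ((a≢c ∷ _) ∷ _) _ = a , here refl , c , a≢c , there (here refl)
two-of {xs = _ ∷ []} _ (s≤s ())

inhabited : ∀ {A : Set} {xs : List A} → 1 ≤ length xs → Inhabited xs
inhabited {xs = x ∷ _} _ = x , here refl

nonempty : ∀ {A : Set} {xs : List A} → Inhabited xs → 1 ≤ length xs
nonempty {xs = _ ∷ _} _ = s≤s z≤n

-- The induction on the number of vertices

module Bound {V : Set} (_≟_ : B.DecidableEquality V) {k} (col : V → V → Fin k) (col-sym : ∀ x y → col x y ≡ col y x)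
  (gallai : ∀ {x y z} → x ≢ y → y ≢ z → x ≢ z → col x y ≡ col y z ⊎ col y z ≡ col x z ⊎ col x y ≡ col x z)
  {c₁ c₂ : Fin k} (c₁≢c₂ : c₁ ≢ c₂) where
  open GallaiColoured _≟_ col col-sym gallai

  record _⊑_ (ys xs : List V) : Set where
    field
      unique : Unique ys
      incl   : ∀ {x} → x ∈ ys → x ∈ xs

  Uncut : Fin k → Fin k → List V → Set
  Uncut r b A = ¬ Cut r b A

  ⊑ˡ : ∀ {xs S T} → Unique xs → xs ↭ S ++ T → S ⊑ xs
  ⊑ˡ {S = S} u p = record
    { unique = proj₁ (Unique-++⁻ S (Permutation.Unique-resp-↭ (setoid V) (↭⇒↭ₛ p) u))
    ; incl   = λ x∈ → ∈-resp-↭ (↭-sym p) (∈-++⁺ˡ x∈) }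

  ⊑ʳ : ∀ {xs S T} → Unique xs → xs ↭ S ++ T → T ⊑ xs
  ⊑ʳ {S = S} u p = record
    { unique = proj₂ (Unique-++⁻ S (Permutation.Unique-resp-↭ (setoid V) (↭⇒↭ₛ p) u))
    ; incl   = λ x∈ → ∈-resp-↭ (↭-sym p) (∈-++⁺ʳ S x∈) }

  ⊑-trans : ∀ {xs ys zs} → xs ⊑ ys → ys ⊑ zs → xs ⊑ zs
  ⊑-trans p q = record { unique = _⊑_.unique p ; incl = _⊑_.incl q ∘ _⊑_.incl p }

  parts-length : ∀ {xs S T : List V} → xs ↭ S ++ T → length xs ≡ length S + length T
  parts-length {S = S} p = trans (↭-length p) (List.length-++ S)

  -- A minimal side of a cut is a component of the graph of the edges coloured neither r nor b.  Its existence is only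
  -- needed up to double negation, which avoids deciding Cut.
  record Component (r b : Fin k) (u : V) (S : List V) : Set where
    field
      {A Q}  : List V
      parts  : S ↭ A ++ Q
      member : u ∈ A
      cross  : Between (Either r b) A Q
      uncut  : Uncut r b A

  component-fuel : ∀ n {r b u S} → length S ≤ n → u ∈ S → ¬ ¬ Component r b u S
  component-fuel zero {S = _ ∷ _} () _
  component-fuel (suc n) {r} {b} {u} {S} l u∈S none = ¬¬-excluded-middle λ where
      (no uncut) → none (record
        { A = S ; Q = [] ; parts = ↭-reflexive (sym (List.++-identityʳ S)) ; member = u∈S ; cross = λ _ () ; uncut = uncut })
      (yes cut) → recurse cut
    where
    refine : ∀ {S₁ S₂} → S ↭ S₁ ++ S₂ → Inhabited S₂ → Between (Either r b) S₁ S₂ → u ∈ S₁ → ⊥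
    refine {S₁} {S₂} p ne cr u∈S₁ = component-fuel n shorter u∈S₁ λ comp →
      let open Component comp in none (record
        { A = A ; Q = Q ++ S₂
        ; parts = ↭-trans p (↭-trans (++⁺ʳ S₂ parts) (↭-reflexive (List.++-assoc A Q S₂)))
        ; member = member
        ; cross = λ x∈A y∈ → case ∈-++⁻ Q y∈ of λ where
            (inj₁ y∈Q) → cross x∈A y∈Q
            (inj₂ y∈S₂) → cr (∈-resp-↭ (↭-sym parts) (∈-++⁺ˡ x∈A)) y∈S₂
        ; uncut = uncut })
      where
      shorter : length S₁ ≤ n
      shorter = ℕ.≤-pred (begin
        suc (length S₁)         ≡⟨ ℕ.+-comm 1 _ ⟩
        length S₁ + 1           ≤⟨ ℕ.+-monoʳ-≤ (length S₁) (nonempty ne) ⟩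
        length S₁ + length S₂   ≡⟨ parts-length {S = S₁} p ⟨
        length S                ≤⟨ l ⟩
        suc n                   ∎)
        where open ℕ.≤-Reasoning

    recurse : Cut r b S → ⊥
    recurse cut with ∈-++⁻ (Cut.S cut) (∈-resp-↭ (Cut.parts cut) u∈S)
    ... | inj₁ u∈ = refine (Cut.parts cut) (Cut.inT cut) (Cut.cross cut) u∈
    ... | inj₂ u∈ = refine (↭-trans (Cut.parts cut) (++-comm (Cut.S cut) (Cut.T cut))) (Cut.inS cut)
                           (λ x y → Either-sym (Cut.cross cut y x)) u∈

  component : ∀ {r b u S} → u ∈ S → ¬ ¬ Component r b u S
  component = component-fuel _ ℕ.≤-refl

  -- If `w` saw A in both colours, its r-neighbours and its b-neighbours in A would form a cut of A,
  -- because an edge between them closes a triangle with w. This makes components modules.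
  uncut-uniform : ∀ {r b A u w} → r ≢ b → Uncut r b A → (∀ {x} → x ∈ A → Either r b x w) → u ∈ A → E r u w →
                  ∀ {x} → x ∈ A → E r x w
  uncut-uniform {r} {b} {A} {u} {w} r≢b uncut e u∈A uw {x} x∈A with e x∈A
  ... | inj₁ xw = xw
  ... | inj₂ xw = contradiction
    (filter-cut (λ y → E? r y w) (u , u∈A , uw) (x , x∈A , λ f → r≢b (E-unique f xw))
       λ y∈ z∈ yw ¬zw → case e z∈ of λ where
         (inj₁ zw) → contradiction zw ¬zw
         (inj₂ zw) → triangle r≢b yw (E-sym zw))
    uncut

  -- In terms of joins, W₄ = 2K₁ + P₃ = K₁ + C₄, C₄ = 2K₁ + 2K₁ lies in K₁ + P₃, and P₃ = K₁ + 2K₁.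
  -- These identities determine how far the state of a joining colour drops.
  module Joins {i : Fin k} {A B : List V} {xs : List V} (A⊆ : ∀ {x} → x ∈ A → x ∈ xs) (B⊆ : ∀ {x} → x ∈ B → x ∈ xs)
               (join : Between (E i) A B) where
    two-P3 : Two _≢_ (_∈ A) → P3 _≢_ (E i) (_∈ B) → W4 _≢_ (E i) (_∈ xs)
    two-P3 (b , b∈ , d , b≢d , d∈) p =
      b , A⊆ b∈ , d , (b≢d , A⊆ d∈) , P3-map id id id (λ x∈ → join b∈ x∈ , join d∈ x∈ , B⊆ x∈) p

    one-C4 : Inhabited A → C4 _≢_ (E i) (_∈ B) → W4 _≢_ (E i) (_∈ xs)
    one-C4 (v , v∈) (b , b∈ , d , (b≢d , d∈) , t) =
      b , B⊆ b∈ , d , (b≢d , B⊆ d∈) , v , (E-sym (join v∈ b∈) , E-sym (join v∈ d∈) , A⊆ v∈) ,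
      Two-map id id (λ (ba , da , a∈) → join v∈ a∈ , ba , da , B⊆ a∈) t

    two-two : Two _≢_ (_∈ A) → Two _≢_ (_∈ B) → C4 _≢_ (E i) (_∈ xs)
    two-two (b , b∈ , d , b≢d , d∈) t =
      b , A⊆ b∈ , d , (b≢d , A⊆ d∈) , Two-map id id (λ x∈ → join b∈ x∈ , join d∈ x∈ , B⊆ x∈) t

    one-P3 : Inhabited A → P3 _≢_ (E i) (_∈ B) → C4 _≢_ (E i) (_∈ xs)
    one-P3 (v , v∈) (h , h∈ , t) =
      h , B⊆ h∈ , v , ((λ { refl → E-irr (join v∈ h∈) }) , A⊆ v∈) ,
      Two-map id id (λ (ha , a∈) → ha , join v∈ a∈ , B⊆ a∈) t

    one-two : Inhabited A → Two _≢_ (_∈ B) → P3 _≢_ (E i) (_∈ xs)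
    one-two (v , v∈) t = v , A⊆ v∈ , Two-map id id (λ x∈ → join v∈ x∈ , B⊆ x∈) t

  Avoids : State → Fin k → Pred V 0ℓ → Set
  Avoids full     i P = ¬ W4 _≢_ (E i) P
  Avoids c4       i P = ¬ C4 _≢_ (E i) P
  Avoids matching i P = ¬ P3 _≢_ (E i) P

  Avoids-⊆ : ∀ s {i} {P Q : Pred V 0ℓ} → (∀ {x} → P x → Q x) → Avoids s i Q → Avoids s i P
  Avoids-⊆ full     g a = a ∘ W4-map id id id g
  Avoids-⊆ c4       g a = a ∘ C4-map id id id g
  Avoids-⊆ matching g a = a ∘ P3-map id id id g

  Sat : Vec State k → List V → Set
  Sat σ xs = ∀ i → Avoids (lookup σ i) i (_∈ xs)

  Sat-⊑ : ∀ {σ xs ys} → ys ⊑ xs → Sat σ xs → Sat σ ys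
  Sat-⊑ {σ} s sat i = Avoids-⊆ (lookup σ i) (_⊑_.incl s) (sat i)

  Sat-update : ∀ {σ xs} i s → Avoids s i (_∈ xs) → Sat σ xs → Sat (σ [ i ]≔ s) xs
  Sat-update {σ} {xs} i s a sat j with j Fin.≟ i
  ... | yes refl = subst (λ t → Avoids t i (_∈ xs)) (sym (Vec.lookup∘update i σ s)) a
  ... | no j≢i   = subst (λ t → Avoids t j (_∈ xs)) (sym (Vec.lookup∘update′ j≢i σ s)) (sat j)

  -- The summand for the C₄-free colours pays for a vertex joined to all others in a full colour: deleting it makes that
  -- colour C₄-free.
  Bounded : Vec State k → List V → Set
  Bounded σ xs = length xs + weight squareFree σ ≤ extremal (weight active σ)

  module Step {σ xs} (unique : Unique xs) (sat : Sat σ xs)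
    (smaller : ∀ τ {ys} → Unique ys → length ys < length xs → Sat τ ys → Bounded τ ys) where

    c a : ℕ
    c = weight squareFree σ
    a = weight active σ

    avoids : ∀ {i s} → lookup σ i ≡ s → Avoids s i (_∈ xs)
    avoids {i} refl = sat i

    short : length xs ≤ 2 → Bounded σ xs
    short l = ℕ.≤-trans (ℕ.+-mono-≤ l (squareFree≤active σ)) (extremal-linear a)

    active-suc : ∀ {i} → lookup σ i ≢ matching → ∃ λ n → a ≡ suc n
    active-suc {i} ≢m = _ , sym (active-drop σ i ≢m)

    active-two : ∀ {i j} → i ≢ j → lookup σ i ≢ matching → lookup σ j ≢ matching → ∃ λ n → a ≡ 2 + n
    active-two {i} {j} i≢j iₘ jₘ = _ , trans (sym (active-drop σ i iₘ)) (cong suc (sym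
      (active-drop (σ [ i ]≔ matching) j (jₘ ∘ trans (sym (Vec.lookup∘update′ (i≢j ∘ sym) σ matching))))))

    -- The induction hypothesis on A for weakened states. Going from `full` to `matching` only loses
    -- an active colour. From `c4` to `matching` a unit of c is lost as well, hence the `suc` on the
    -- right; from `full` to `c4` a unit is gained, hence the `suc` on the left.
    module Lower {A} (A⊑ : A ⊑ xs) (A< : length A < length xs) where
      private
        hypothesis : ∀ τ → Sat τ A → Bounded τ A
        hypothesis τ = smaller τ (_⊑_.unique A⊑) A<

        base : Sat σ A
        base = Sat-⊑ {σ} A⊑ sat

      matched : ∀ {i n} → a ≡ suc n → lookup σ i ≡ full → ¬ P3 _≢_ (E i) (_∈ A) → length A + c ≤ extremal n
      matched {i} eₙ e noP3 =
        subst₂ (λ x y → length A + x ≤ extremal y) (squareFree-drop σ i e)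
          (ℕ.suc-injective (trans (active-drop σ i (full≢ e)) eₙ))
          (hypothesis (σ [ i ]≔ matching) (Sat-update {σ} i matching noP3 base))

      matched-c4 : ∀ {i n} → a ≡ suc n → lookup σ i ≡ c4 → ¬ P3 _≢_ (E i) (_∈ A) → length A + c ≤ suc (extremal n)
      matched-c4 {i} eₙ e noP3 =
        subst₂ (λ x y → length A + x ≤ suc (extremal y)) (c4-drop σ i e)
          (ℕ.suc-injective (trans (active-drop σ i (c4≢ e)) eₙ))
          (ℕ.≤-trans (ℕ.≤-reflexive (ℕ.+-suc (length A) _))
            (s≤s (hypothesis (σ [ i ]≔ matching) (Sat-update {σ} i matching noP3 base))))

      squared : ∀ {i} → lookup σ i ≡ full → ¬ C4 _≢_ (E i) (_∈ A) → suc (length A + c) ≤ extremal a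
      squared {i} e noC4 =
        subst₂ _≤_ (trans (cong (length A +_) (proj₁ (full→c4 σ i e))) (ℕ.+-suc (length A) c)) (cong extremal (proj₂ (full→c4 σ i e)))
          (hypothesis (σ [ i ]≔ c4) (Sat-update {σ} i c4 noC4 base))

      matched₂ : ∀ {i j n} → a ≡ 2 + n → i ≢ j → lookup σ i ≡ full → lookup σ j ≡ full →
                 ¬ P3 _≢_ (E i) (_∈ A) → ¬ P3 _≢_ (E j) (_∈ A) → length A + c ≤ extremal n
      matched₂ {i} {j} eₙ i≢j eᵢ eⱼ noPᵢ noPⱼ =
        subst₂ (λ x y → length A + x ≤ extremal y) (trans (squareFree-drop (σ [ i ]≔ matching) j eⱼ′) (squareFree-drop σ i eᵢ))
          (ℕ.suc-injective (trans (active-drop (σ [ i ]≔ matching) j (full≢ eⱼ′)) (ℕ.suc-injective (trans (active-drop σ i (full≢ eᵢ)) eₙ))))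
          (hypothesis ((σ [ i ]≔ matching) [ j ]≔ matching) (Sat-update {σ [ i ]≔ matching} j matching noPⱼ (Sat-update {σ} i matching noPᵢ base)))
        where
        eⱼ′ : lookup (σ [ i ]≔ matching) j ≡ full
        eⱼ′ = trans (Vec.lookup∘update′ (i≢j ∘ sym) σ matching) eⱼ

      matched-squared : ∀ {i j n} → a ≡ suc n → i ≢ j → lookup σ i ≡ full → lookup σ j ≡ full →
                        ¬ C4 _≢_ (E i) (_∈ A) → ¬ P3 _≢_ (E j) (_∈ A) → suc (length A + c) ≤ extremal n
      matched-squared {i} {j} eₙ i≢j eᵢ eⱼ noCᵢ noPⱼ =
        subst₂ (λ x y → x ≤ extremal y)
          (trans (cong (length A +_) (trans (squareFree-drop (σ [ i ]≔ c4) j eⱼ′) (proj₁ (full→c4 σ i eᵢ)))) (ℕ.+-suc (length A) c))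
          (ℕ.suc-injective (trans (active-drop (σ [ i ]≔ c4) j (full≢ eⱼ′)) (trans (proj₂ (full→c4 σ i eᵢ)) eₙ)))
          (hypothesis ((σ [ i ]≔ c4) [ j ]≔ matching) (Sat-update {σ [ i ]≔ c4} j matching noPⱼ (Sat-update {σ} i c4 noCᵢ base)))
        where
        eⱼ′ : lookup (σ [ i ]≔ c4) j ≡ full
        eⱼ′ = trans (Vec.lookup∘update′ (i≢j ∘ sym) σ c4) eⱼ

    two-halves : ∀ {n x} → a ≡ suc n → x ≤ extremal n + extremal n → x ≤ extremal a
    two-halves {n} {x} eₙ x≤ = begin
      x                         ≤⟨ x≤ ⟩
      extremal n + extremal n   ≡⟨ cong (extremal n +_) (ℕ.+-identityʳ _) ⟨
      2 * extremal n            ≤⟨ extremal-double n ⟩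
      extremal (suc n)          ≡⟨ cong extremal eₙ ⟨
      extremal a                ∎
      where open ℕ.≤-Reasoning

    shorterˡ : ∀ {S T} → xs ↭ S ++ T → Inhabited T → length S < length xs
    shorterˡ {S} {T} p ne = subst (suc (length S) ≤_) (sym (parts-length {S = S} p))
      (ℕ.≤-trans (ℕ.≤-reflexive (ℕ.+-comm 1 _)) (ℕ.+-monoʳ-≤ (length S) (nonempty ne)))

    shorterʳ : ∀ {S T} → xs ↭ S ++ T → Inhabited S → length T < length xs
    shorterʳ {S} {T} p ne = shorterˡ {T} {S} (↭-trans p (++-comm S T)) ne

    module Split {i S T} (p : xs ↭ S ++ T) (join : Between (E i) S T) where
      S⊑ : S ⊑ xs
      S⊑ = ⊑ˡ unique p
      T⊑ : T ⊑ xs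
      T⊑ = ⊑ʳ {S = S} unique p
      open _⊑_ S⊑ renaming (unique to S-unique; incl to S⊆)
      open _⊑_ T⊑ renaming (unique to T-unique; incl to T⊆)
      open Joins S⊆ T⊆ join
      module Flip = Joins T⊆ S⊆ (λ t s → E-sym (join s t))

      both-large : 2 ≤ length S → 2 ≤ length T → Bounded σ xs
      both-large 2≤S 2≤T = go (lookup σ i) refl
        where
        twoS : Two _≢_ (_∈ S)
        twoS = two-of S-unique 2≤S
        twoT : Two _≢_ (_∈ T)
        twoT = two-of T-unique 2≤T
        inS : Inhabited S
        inS = inhabited (ℕ.≤-trans (s≤s z≤n) 2≤S)
        inT : Inhabited T
        inT = inhabited (ℕ.≤-trans (s≤s z≤n) 2≤T)

        go : ∀ s → lookup σ i ≡ s → Bounded σ xs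
        go c4       e = contradiction (two-two twoS twoT) (avoids e)
        go matching e = contradiction (one-two inS twoT) (avoids e)
        go full     e =
          let n , eₙ = active-suc (full≢ e)
              S≤ = Lower.matched S⊑ (shorterˡ {S} p inT) eₙ e (λ q → avoids e (Flip.two-P3 twoT q))
              T≤ = Lower.matched T⊑ (shorterʳ {S} p inS) eₙ e (λ q → avoids e (two-P3 twoS q))
          in two-halves eₙ (begin
            length xs + c                    ≡⟨ cong (_+ c) (parts-length {S = S} p) ⟩
            -- Each part brings its own copy of `c`, and only one is required.
            length S + length T + c          ≤⟨ ℕ.m≤m+n _ c ⟩
            length S + length T + c + c      ≡⟨ shuffle (length S) (length T) c ⟩
            (length S + c) + (length T + c)  ≤⟨ ℕ.+-mono-≤ S≤ T≤ ⟩
            extremal n + extremal n          ∎)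
          where
          open ℕ.≤-Reasoning
          shuffle : ∀ x y z → x + y + z + z ≡ (x + z) + (y + z)
          shuffle = solve-∀

      one-large : length S ≡ 1 → 2 ≤ length T → Bounded σ xs
      one-large S≡1 2≤T = go (lookup σ i) refl
        where
        twoT : Two _≢_ (_∈ T)
        twoT = two-of T-unique 2≤T
        inS : Inhabited S
        inS = inhabited (ℕ.≤-reflexive (sym S≡1))
        T< : length T < length xs
        T< = shorterʳ {S} p inS

        total : length xs ≡ suc (length T)
        total = trans (parts-length {S = S} p) (cong (_+ length T) S≡1)

        go : ∀ s → lookup σ i ≡ s → Bounded σ xs
        go matching e = contradiction (one-two inS twoT) (avoids e)
        go full     e = subst (λ m → m + c ≤ extremal a) (sym total)
          (Lower.squared T⊑ T< e (λ q → avoids e (one-C4 inS q)))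
        go c4       e =
          let n , eₙ = active-suc (c4≢ e)
              T≤ = Lower.matched-c4 T⊑ T< eₙ e (λ q → avoids e (one-P3 inS q))
          in begin
            length xs + c         ≡⟨ cong (_+ c) total ⟩
            suc (length T + c)    ≤⟨ s≤s T≤ ⟩
            2 + extremal n        ≤⟨ extremal-step n ⟩
            extremal (suc n)      ≡⟨ cong extremal eₙ ⟨
            extremal a            ∎
          where open ℕ.≤-Reasoning

    split-bounded : ∀ {i S T} → xs ↭ S ++ T → Between (E i) S T → Inhabited S → Inhabited T → Bounded σ xs
    split-bounded {S = _ ∷ []}    {_ ∷ []}    p join _ _ = short (ℕ.≤-reflexive (↭-length p))
    split-bounded {S = _ ∷ []}    {_ ∷ _ ∷ _} p join _ _ = Split.one-large p join refl (s≤s (s≤s z≤n))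
    split-bounded {S = S@(_ ∷ _ ∷ _)} {T@(_ ∷ [])} p join _ _ =
      Split.one-large (↭-trans p (++-comm S T)) (λ t s → E-sym (join s t)) refl (s≤s (s≤s z≤n))
    split-bounded {S = _ ∷ _ ∷ _} {_ ∷ _ ∷ _} p join _ _ = Split.both-large p join (s≤s (s≤s z≤n)) (s≤s (s≤s z≤n))

    -- Arguing towards ⊥ lets the doubly negated `component` be used directly, and it excludes every
    -- split of X in a single colour.
    module Unsplit (unbounded : ¬ Bounded σ xs) where
      no-split : ∀ {i S T} → xs ↭ S ++ T → Between (E i) S T → Inhabited S → ¬ Inhabited T
      no-split p join s t = unbounded (split-bounded p join s t)

      large : 3 ≤ length xs
      large = ℕ.≰⇒> (unbounded ∘ short)

      record Block (r b : Fin k) (A RA BA : List V) : Set where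
        field
          r≢b    : r ≢ b
          parts  : xs ↭ A ++ RA ++ BA
          joinR  : Between (E r) A RA
          joinB  : Between (E b) A BA
          across : Between (Either r b) RA BA
          two    : 2 ≤ length A
          rest   : Inhabited (RA ++ BA)

      Block-swap : ∀ {r b A RA BA} → Block r b A RA BA → Block b r A BA RA
      Block-swap {A = A} {RA} {BA} block = record
        { r≢b = r≢b ∘ sym ; parts = ↭-trans parts (++⁺ˡ A (++-comm RA BA)) ; joinR = joinB ; joinB = joinR
        ; across = λ x y → swap (Either-sym (across y x)) ; two = two
        ; rest = let z , z∈ = rest in z , ∈-resp-↭ (++-comm RA BA) z∈ }
        where open Block block

      module Blocks {r b A RA BA} (block : Block r b A RA BA) where
        open Block block
        A⊑ : A ⊑ xs
        A⊑ = ⊑ˡ unique parts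
        RB⊑ : (RA ++ BA) ⊑ xs
        RB⊑ = ⊑ʳ {S = A} unique parts
        RA⊑ : RA ⊑ xs
        RA⊑ = ⊑-trans (⊑ˡ (_⊑_.unique RB⊑) ↭-refl) RB⊑
        BA⊑ : BA ⊑ xs
        BA⊑ = ⊑-trans (⊑ʳ {S = RA} (_⊑_.unique RB⊑) ↭-refl) RB⊑

        twoA : Two _≢_ (_∈ A)
        twoA = two-of (_⊑_.unique A⊑) two
        inA : Inhabited A
        inA = inhabited (ℕ.≤-trans (s≤s z≤n) two)

        total : length xs ≡ length A + (length RA + length BA)
        total = trans (parts-length {S = A} parts) (cong (length A +_) (List.length-++ RA))

        A<xs : Inhabited (RA ++ BA) → length A < length xs
        A<xs = shorterˡ {A} parts

        RA<xs : length RA < length xs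
        RA<xs = ℕ.≤-<-trans (ℕ.≤-trans (ℕ.m≤m+n _ _) (ℕ.≤-reflexive (sym (List.length-++ RA)))) (shorterʳ {A} parts inA)
        BA<xs : length BA < length xs
        BA<xs = ℕ.≤-<-trans (ℕ.≤-trans (ℕ.m≤n+m _ _) (ℕ.≤-reflexive (sym (List.length-++ RA)))) (shorterʳ {A} parts inA)

        -- With RA empty, b alone would join A to the rest.
        inRA : Inhabited RA
        inRA = go RA refl
          where
          go : ∀ zs → RA ≡ zs → Inhabited RA
          go (z ∷ _) refl = z , here refl
          go []      refl = ⊥-elim (no-split parts joinB inA rest)

        open Joins (_⊑_.incl A⊑) (_⊑_.incl RA⊑) joinR
        module Flip = Joins (_⊑_.incl RA⊑) (_⊑_.incl A⊑) (λ x y → E-sym (joinR y x))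

        r-active : lookup σ r ≢ matching
        r-active e = avoids e (Flip.one-two inRA twoA)

        r-full : 2 ≤ length RA → lookup σ r ≡ full
        r-full l = go (lookup σ r) refl
          where
          go : ∀ s → lookup σ r ≡ s → lookup σ r ≡ full
          go full     e = e
          go c4       e = contradiction (two-two twoA (two-of (_⊑_.unique RA⊑) l)) (avoids e)
          go matching e = contradiction e r-active

        A-noC4 : lookup σ r ≡ full → ¬ C4 _≢_ (E r) (_∈ A)
        A-noC4 e q = avoids e (Flip.one-C4 inRA q)

        A-noP3 : 2 ≤ length RA → ¬ P3 _≢_ (E r) (_∈ A)
        A-noP3 l q = avoids (r-full l) (Flip.two-P3 (two-of (_⊑_.unique RA⊑) l) q)

        RA-noP3 : lookup σ r ≡ full → ¬ P3 _≢_ (E r) (_∈ RA)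
        RA-noP3 e q = avoids e (two-P3 twoA q)

      -- Let p be the only vertex of RA. If BA is a single vertex q, the edge p q repeats the colour
      -- from A to p or to q, and that vertex splits off. If BA is larger, b is a matching on A and
      -- on BA. The vertex p is then paid for by the unit that c gains on A when r drops to C₄-free
      -- there, or, if r is C₄-free already, by the second copy of c.
      small-block : ∀ {r b A RA BA} → Block r b A RA BA → length RA ≢ 1
      small-block {A = A} {p ∷ []} {[]} block _ = case proj₂ (Blocks.inRA (Block-swap block)) of λ ()
      small-block {A = A} {p ∷ []} {q ∷ []} block _ = case across (here refl) (here refl) of λ where
          (inj₁ e) → no-split {S = p ∷ []} {T = A ++ q ∷ []} (↭-trans parts (shift p A (q ∷ [])))
             (λ { (here refl) y∈ → case ∈-++⁻ A y∈ of λ where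
                   (inj₁ y∈A) → E-sym (joinR y∈A (here refl))
                   (inj₂ (here refl)) → e
                ; (there ()) _ })
             (p , here refl) (q , ∈-++⁺ʳ A (here refl))
          (inj₂ e) → no-split {S = q ∷ []} {T = A ++ p ∷ []}
             (↭-trans (Block.parts (Block-swap block)) (shift q A (p ∷ [])))
             (λ { (here refl) y∈ → case ∈-++⁻ A y∈ of λ where
                   (inj₁ y∈A) → E-sym (joinB y∈A (here refl))
                   (inj₂ (here refl)) → E-sym e
                ; (there ()) _ })
             (q , here refl) (p , ∈-++⁺ʳ A (here refl))
        where open Block block
      small-block {r} {b} {A} {RA@(p ∷ [])} {BA@(_ ∷ _ ∷ _)} block _ = unbounded (go (lookup σ r) refl)
        where
        open Block block
        open Blocks block
        module Swapped = Blocks (Block-swap block)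

        b-full : lookup σ b ≡ full
        b-full = Swapped.r-full (s≤s (s≤s z≤n))

        BA≤ : ∀ {n} → a ≡ suc n → length BA + c ≤ extremal n
        BA≤ eₙ = Lower.matched BA⊑ BA<xs eₙ b-full (Swapped.RA-noP3 b-full)

        open ℕ.≤-Reasoning
        shuffle : ∀ x y z → x + (1 + y) + z + z ≡ suc (x + z) + (y + z)
        shuffle = solve-∀
        shuffle′ : ∀ x y z → x + (z + y) + z ≡ (x + z) + (y + z)
        shuffle′ = solve-∀

        go : ∀ s → lookup σ r ≡ s → Bounded σ xs
        go matching e = contradiction e r-active
        go full     e =
          let n , eₙ = active-suc (full≢ e)
              A≤ = Lower.matched-squared A⊑ (A<xs rest) eₙ r≢b e b-full (A-noC4 e) (Swapped.A-noP3 (s≤s (s≤s z≤n)))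
          in two-halves eₙ (begin
            length xs + c                            ≡⟨ cong (_+ c) total ⟩
            length A + (1 + length BA) + c           ≤⟨ ℕ.m≤m+n _ c ⟩
            length A + (1 + length BA) + c + c       ≡⟨ shuffle (length A) (length BA) c ⟩
            suc (length A + c) + (length BA + c)     ≤⟨ ℕ.+-mono-≤ A≤ (BA≤ eₙ) ⟩
            extremal n + extremal n                  ∎)
        go c4       e =
          let n , eₙ = active-suc (c4≢ e)
              A≤ = Lower.matched A⊑ (A<xs rest) eₙ b-full (Swapped.A-noP3 (s≤s (s≤s z≤n)))
          in two-halves eₙ (begin
            length xs + c                            ≡⟨ cong (_+ c) total ⟩
            -- Here `c` is at least one, as r itself is C₄-free.
            length A + (1 + length BA) + c           ≤⟨ ℕ.+-monoˡ-≤ c (ℕ.+-monoʳ-≤ (length A) (ℕ.+-monoˡ-≤ (length BA)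
                                                          (ℕ.≤-trans (s≤s z≤n) (ℕ.≤-reflexive (c4-drop σ r e))))) ⟩
            length A + (c + length BA) + c           ≡⟨ shuffle′ (length A) (length BA) c ⟩
            (length A + c) + (length BA + c)         ≤⟨ ℕ.+-mono-≤ A≤ (BA≤ eₙ) ⟩
            extremal n + extremal n                  ∎)

      block-large : ∀ {r b A RA BA} → Block r b A RA BA → 2 ≤ length RA
      block-large {RA = RA} block with RA | Blocks.inRA block | small-block block
      ... | _ ∷ []    | _ | ≢1 = contradiction refl ≢1
      ... | _ ∷ _ ∷ _ | _ | _  = s≤s (s≤s z≤n)

      block-bounded : ∀ {r b A RA BA n} → a ≡ 2 + n → Block r b A RA BA → length A + c ≤ extremal n
      block-bounded eₙ block = Lower.matched₂ A⊑ (A<xs rest) eₙ r≢b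
        (r-full (block-large block)) (Swapped.r-full (block-large (Block-swap block)))
        (A-noP3 (block-large block)) (Swapped.A-noP3 (block-large (Block-swap block)))
        where
        open Block block
        open Blocks block
        module Swapped = Blocks (Block-swap block)

      two-length : ∀ {x y : V} {zs} → x ≢ y → x ∈ zs → y ∈ zs → 2 ≤ length zs
      two-length x≢y (here refl) (here refl) = contradiction refl x≢y
      two-length {zs = _ ∷ _ ∷ _} _ _ _      = s≤s (s≤s z≤n)
      two-length {zs = _ ∷ []} _ (there ()) _
      two-length {zs = _ ∷ []} _ (here _) (there ())

      -- T is sorted by its colour towards `u`, which `uncut-uniform` extends to all of A. An edge
      -- between RA and BA closes a triangle with u whose other edges are r and b.
      make-block : ∀ {r b u A T} → r ≢ b → xs ↭ A ++ T → Between (Either r b) A T → Uncut r b A → u ∈ A → 2 ≤ length A →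
                   Inhabited T → ∃₂ λ RA BA → Block r b A RA BA
      make-block {r} {b} {u} {A} {T} r≢b p cross uncut u∈A 2≤A (t , t∈T) = RA , BA , record
        { r≢b    = r≢b
        ; parts  = ↭-trans p (++⁺ˡ A (filter-↭ (E? r u) T))
        ; joinR  = λ x∈ y∈ → let y∈T , uy = red y∈ in uncut-uniform r≢b uncut (λ z∈ → cross z∈ y∈T) u∈A uy x∈
        ; joinB  = λ x∈ y∈ → let y∈T , uy = blue y∈ in
                     uncut-uniform (r≢b ∘ sym) (uncut ∘ Cut-swap) (λ z∈ → swap (cross z∈ y∈T)) u∈A uy x∈
        ; across = λ x∈ y∈ → triangle r≢b (E-sym (proj₂ (red x∈))) (proj₂ (blue y∈))
        ; two    = 2≤A
        ; rest   = t , ∈-resp-↭ (filter-↭ (E? r u) T) t∈T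
        }
        where
        RA BA : List V
        RA = filter (E? r u) T
        BA = filter (¬? ∘ E? r u) T

        red : ∀ {y} → y ∈ RA → y ∈ T × E r u y
        red = ∈-filter⁻ (E? r u)

        blue : ∀ {y} → y ∈ BA → y ∈ T × E b u y
        blue y∈ with ∈-filter⁻ (¬? ∘ E? r u) y∈
        ... | y∈T , ¬uy with cross u∈A y∈T
        ...   | inj₁ uy = contradiction uy ¬uy
        ...   | inj₂ uy = y∈T , uy

      -- A decidable witness that the component of `x` has at least two vertices, available before
      -- any component is.
      Foreign : Fin k → Fin k → List V → Pred V 0ℓ
      Foreign r b zs x = Any (λ y → x ≢ y × ¬ Either r b x y) zs

      Foreign? : ∀ r b zs → U.Decidable (Foreign r b zs)
      Foreign? r b zs x = any? (λ y → ¬? (x ≟ y) ×-dec ¬? (Either? r b x y)) zs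

      no-foreign : ∀ {r b zs} → (∀ {x} → x ∈ zs → ¬ Foreign r b zs x) → ∀ {x y} → x ∈ zs → y ∈ zs → x ≢ y → Either r b x y
      no-foreign {r} {b} none {x} {y} x∈ y∈ x≢y with Either? r b x y
      ... | yes e = e
      ... | no ¬e = contradiction (lose y∈ (x≢y , ¬e)) (none x∈)

      module Side {r b A RA BA n} (eₙ : a ≡ 2 + n) (block : Block r b A RA BA) where
        open Block block
        open Blocks block
        module Swapped = Blocks (Block-swap block)

        full-r : lookup σ r ≡ full
        full-r = r-full (block-large block)

        full-b : lookup σ b ≡ full
        full-b = Swapped.r-full (block-large (Block-swap block))

        -- No colour besides r and b occurs in RA, and r is a matching there. With b as the only
        -- active colour, |RA| ≤ f(1) = 4 ≤ 2 f(n).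
        flat : (∀ {x y} → x ∈ RA → y ∈ RA → x ≢ y → Either r b x y) → length RA ≤ extremal n + extremal n
        flat e = begin
          length RA                        ≤⟨ ℕ.m≤m+n _ _ ⟩
          length RA + weight squareFree τ  ≤⟨ smaller τ (_⊑_.unique RA⊑) RA<xs satτ ⟩
          extremal (weight active τ)       ≡⟨ cong extremal activeτ ⟩
          2 + 2                            ≤⟨ ℕ.+-mono-≤ 2≤ 2≤ ⟩
          extremal n + extremal n          ∎
          where
          open ℕ.≤-Reasoning
          2≤ : 2 ≤ extremal n
          2≤ = ℕ.≤-trans (ℕ.m≤m+n 2 n) (extremal-linear n)

          none τ : Vec State k
          none = Vec.replicate k matching
          τ    = none [ b ]≔ full

          activeτ : weight active τ ≡ 1
          activeτ = trans (sym (ℕ.+-identityʳ _)) (trans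
            (weight-replace active none full (Vec.lookup-replicate b matching)) (cong (_+ 1) (weight-matching {active} k refl)))

          red-only : ∀ {i} → i ≢ b → ¬ P3 _≢_ (E i) (_∈ RA)
          red-only {i} i≢b p@(h , h∈ , x , (hx , x∈) , _) with e h∈ x∈ (proj₁ hx)
          ... | inj₂ f = contradiction (E-unique hx f) i≢b
          ... | inj₁ f with E-unique hx f
          ...   | refl = RA-noP3 full-r p

          satτ : Sat τ RA
          satτ i with i Fin.≟ b
          ... | yes refl = subst (λ s → Avoids s i (_∈ RA)) (sym (Vec.lookup∘update i none full))
                             (Avoids-⊆ full (_⊑_.incl RA⊑) (avoids full-b))
          ... | no i≢b   = subst (λ s → Avoids s i (_∈ RA))
                             (sym (trans (Vec.lookup∘update′ i≢b none full) (Vec.lookup-replicate i matching)))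
                             (red-only i≢b)

        -- X is a component inside RA, and since A and BA also see it in r and b only, it yields a
        -- block of the whole set. Hence |X| ≤ f(n). An r-edge from X to Q would extend to all of X
        -- and give an r-coloured P₃ in RA, so X and Q are joined in b. Thus b is a matching on Q,
        -- as r is, and |Q| ≤ f(n).
        module WithComponent {x y} (x∈ : x ∈ RA) (y∈ : y ∈ RA) (x≢y : x ≢ y) (¬xy : ¬ Either r b x y)
                             (comp : Component r b x RA) where
          open Component comp renaming (A to X; parts to RA-parts; cross to X-cross; member to x∈X)

          X⊑ : X ⊑ RA
          X⊑ = ⊑ˡ (_⊑_.unique RA⊑) RA-parts
          Q⊑ : Q ⊑ RA
          Q⊑ = ⊑ʳ {S = X} (_⊑_.unique RA⊑) RA-parts
          Q⊑xs : Q ⊑ xs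
          Q⊑xs = ⊑-trans Q⊑ RA⊑

          y∈X : y ∈ X
          y∈X with ∈-++⁻ X (∈-resp-↭ RA-parts y∈)
          ... | inj₁ y∈X = y∈X
          ... | inj₂ y∈Q = contradiction (X-cross x∈X y∈Q) ¬xy

          2≤X : 2 ≤ length X
          2≤X = two-length x≢y x∈X y∈X

          twoX : Two _≢_ (_∈ X)
          twoX = two-of (_⊑_.unique X⊑) 2≤X

          others : List V
          others = Q ++ (A ++ BA)

          xs-parts : xs ↭ X ++ others
          xs-parts = ↭-trans parts (↭-trans (shifts A RA) (↭-trans (++⁺ʳ (A ++ BA) RA-parts)
                       (↭-reflexive (List.++-assoc X Q (A ++ BA)))))

          xs-cross : Between (Either r b) X others
          xs-cross z∈ w∈ with ∈-++⁻ Q w∈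
          ... | inj₁ w∈Q = X-cross z∈ w∈Q
          ... | inj₂ w∈′ with ∈-++⁻ A w∈′
          ...   | inj₁ w∈A  = inj₁ (E-sym (joinR w∈A (_⊑_.incl X⊑ z∈)))
          ...   | inj₂ w∈BA = across (_⊑_.incl X⊑ z∈) w∈BA

          X≤ : length X + c ≤ extremal n
          X≤ = block-bounded eₙ (proj₂ (proj₂ (make-block r≢b xs-parts xs-cross uncut x∈X 2≤X
                 (let v , v∈A = inA in v , ∈-++⁺ʳ Q (∈-++⁺ˡ v∈A)))))

          joinQ : Between (E b) X Q
          joinQ z∈ q∈ with X-cross x∈X q∈
          ... | inj₂ xq = uncut-uniform (r≢b ∘ sym) (uncut ∘ Cut-swap) (λ w∈ → swap (X-cross w∈ q∈)) x∈X xq z∈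
          ... | inj₁ xq = contradiction
            (_ , _⊑_.incl Q⊑ q∈ , Two-map id id
              (λ w∈ → E-sym (uncut-uniform r≢b uncut (λ w∈ → X-cross w∈ q∈) x∈X xq w∈) , _⊑_.incl X⊑ w∈) twoX)
            (RA-noP3 full-r)

          Q≤ : length Q + c ≤ extremal n
          Q≤ = Lower.matched₂ Q⊑xs
            (ℕ.≤-<-trans (subst (length Q ≤_) (sym (parts-length {S = X} RA-parts)) (ℕ.m≤n+m _ _)) RA<xs)
            eₙ r≢b full-r full-b
            (Avoids-⊆ matching (_⊑_.incl Q⊑) (RA-noP3 full-r))
            (λ q → avoids full-b (Joins.two-P3 (_⊑_.incl (⊑-trans X⊑ RA⊑)) (_⊑_.incl Q⊑xs) joinQ twoX q))

          RA≤ : length RA ≤ extremal n + extremal n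
          RA≤ = subst (_≤ extremal n + extremal n) (sym (parts-length {S = X} RA-parts))
                  (ℕ.+-mono-≤ (ℕ.≤-trans (ℕ.m≤m+n _ c) X≤) (ℕ.≤-trans (ℕ.m≤m+n _ c) Q≤))

        side-bounded : length RA ≤ extremal n + extremal n
        side-bounded with search (Foreign? r b RA) RA
        ... | inj₂ none = flat (no-foreign none)
        ... | inj₁ (x , x∈ , some) =
          let y , y∈ , x≢y , ¬xy = find some
          in decidable-stable (length RA ℕ.≤? _) λ large →
               component x∈ (large ∘ WithComponent.RA≤ x∈ y∈ x≢y ¬xy)

      no-block : ∀ {r b A RA BA} → ¬ Block r b A RA BA
      no-block {r} {b} {A} {RA} {BA} block =
        let n , eₙ = active-two r≢b r-active Swapped.r-active
        in unbounded (begin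
          length xs + c                                    ≡⟨ cong (_+ c) total ⟩
          length A + (length RA + length BA) + c           ≡⟨ shuffle (length A) _ c ⟩
          (length A + c) + (length RA + length BA)         ≤⟨ ℕ.+-mono-≤ (block-bounded eₙ block)
                                                                (ℕ.+-mono-≤ (Side.side-bounded eₙ block)
                                                                            (Side.side-bounded eₙ (Block-swap block))) ⟩
          extremal n + ((extremal n + extremal n) + (extremal n + extremal n)) ≡⟨ five (extremal n) ⟩
          5 * extremal n                                   ≤⟨ extremal-quintuple n ⟩
          extremal (2 + n)                                 ≡⟨ cong extremal eₙ ⟨
          extremal a                                       ∎)
        where
        open Block block
        open Blocks block
        module Swapped = Blocks (Block-swap block)
        open ℕ.≤-Reasoning
        shuffle : ∀ x y z → x + y + z ≡ (x + z) + y
        shuffle = solve-∀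
        five : ∀ m → m + ((m + m) + (m + m)) ≡ 5 * m
        five = solve-∀

      -- The case of two colours

      module TwoColours {r b} (r≢b : r ≢ b) (only : ∀ {x y} → x ∈ xs → y ∈ xs → x ≢ y → Either r b x y) where
        two-coloured : TwoColoured (E r) (E b) (_∈ xs)
        two-coloured = record { R? = E? r ; R-sym = E-sym ; R-irr = E-irr ; total = only }

        pair-splits : ∀ {u p ws} → lookup σ r ≡ matching → xs ↭ u ∷ p ∷ ws → E r u p → ⊥
        pair-splits {u} {p} {ws} e q up = no-split {S = u ∷ p ∷ []} q join (u , here refl) inWs
          where
          distinct : Unique (u ∷ p ∷ ws)
          distinct = Permutation.Unique-resp-↭ (setoid V) (↭⇒↭ₛ q) unique

          member : ∀ {x} → x ∈ u ∷ p ∷ ws → x ∈ xs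
          member = ∈-resp-↭ (↭-sym q)

          inWs : Inhabited ws
          inWs = inhabited (ℕ.≤-pred (ℕ.≤-pred (subst (3 ≤_) (↭-length q) large)))

          join : Between (E b) (u ∷ p ∷ []) ws
          join (here refl) w∈ with distinct
          ... | (u≢p ∷ u≢) ∷ (p≢ ∷ _) with only (member (here refl)) (member (there (there w∈))) (All.lookup u≢ w∈)
          ...   | inj₂ uw = uw
          ...   | inj₁ uw = contradiction
                  (u , member (here refl) , p , (up , member (there (here refl))) , _ , All.lookup p≢ w∈ , uw , member (there (there w∈)))
                  (avoids e)
          join (there (here refl)) w∈ with distinct
          ... | (u≢p ∷ u≢) ∷ (p≢ ∷ _) with only (member (there (here refl))) (member (there (there w∈))) (All.lookup p≢ w∈)
          ...   | inj₂ pw = pw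
          ...   | inj₁ pw = contradiction
                  (p , member (there (here refl)) , u , (E-sym up , member (here refl)) , _ , All.lookup u≢ w∈ , pw , member (there (there w∈)))
                  (avoids e)
          join (there (there ())) _

        -- If r were a matching, a vertex together with its r-partner, or alone if it has none,
        -- would be joined to the rest in b and split off.
        not-matching : lookup σ r ≢ matching
        not-matching e = go xs ↭-refl
          where
          go : ∀ zs → xs ↭ zs → ⊥
          go []       q = contradiction (subst (3 ≤_) (↭-length q) large) λ ()
          go (u ∷ zs) q with search (E? r u) zs
          ... | inj₁ (p , p∈ , up) with ∈-∃++ p∈
          ...   | ys , ws , refl = pair-splits e (↭-trans q (prep u (shift p ys ws))) up
          go (u ∷ zs) q | inj₂ none = no-split {S = u ∷ []} q join (u , here refl)
              (inhabited (ℕ.≤-trans (s≤s z≤n) (ℕ.≤-pred (subst (3 ≤_) (↭-length q) large))))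
            where
            join : Between (E b) (u ∷ []) zs
            join (here refl) z∈ with Permutation.Unique-resp-↭ (setoid V) (↭⇒↭ₛ q) unique
            ... | u∉ ∷ _ with only (∈-resp-↭ (↭-sym q) (here refl)) (∈-resp-↭ (↭-sym q) (there z∈)) (All.lookup u∉ z∈)
            ...   | inj₁ uz = contradiction uz (none z∈)
            ...   | inj₂ uz = uz
            join (there ()) _

        C4-bounded : ¬ C4 _≢_ (E r) (_∈ xs) → ¬ W4 _≢_ (E b) (_∈ xs) → length xs ≤ 8
        C4-bounded noC4 noW4 = ℕ.≮⇒≥ λ 9≤ →
          Ramsey.no-nine two-coloured noC4 noW4 (Unique.take⁺ 9 unique) (∈-take⁻ 9) (length-take-≤ 9 xs 9≤)

      avoids-W4 : ∀ {i} → lookup σ i ≢ matching → ¬ W4 _≢_ (E i) (_∈ xs)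
      avoids-W4 {i} ≢m = go (lookup σ i) refl
        where
        go : ∀ s → lookup σ i ≡ s → ¬ W4 _≢_ (E i) (_∈ xs)
        go full     e = avoids e
        go matching e = contradiction e ≢m
        go c4       e (b , b∈ , d , bd , h , hₚ , t) = avoids e (b , b∈ , d , bd , Two-map id id proj₂ t)

      not-two-coloured : ∀ {r b} → r ≢ b → ¬ (∀ {x y} → x ∈ xs → y ∈ xs → x ≢ y → Either r b x y)
      not-two-coloured {r} {b} r≢b only = go (lookup σ r) (lookup σ b) refl refl
        where
        only′ : ∀ {x y} → x ∈ xs → y ∈ xs → x ≢ y → Either b r x y
        only′ x∈ y∈ x≢y = swap (only x∈ y∈ x≢y)

        module RB = TwoColours r≢b only
        module BR = TwoColours (r≢b ∘ sym) only′

        noR = avoids-W4 RB.not-matching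
        noB = avoids-W4 BR.not-matching

        n = proj₁ (active-two r≢b RB.not-matching BR.not-matching)
        eₙ = proj₂ (active-two r≢b RB.not-matching BR.not-matching)

        open ℕ.≤-Reasoning

        from-eight : length xs ≤ 8 → ⊥
        from-eight l = unbounded (begin
          -- Raising 8 to 12 makes the sum exactly 14 + n, because a = 2 + n.
          length xs + c      ≤⟨ ℕ.+-mono-≤ (ℕ.≤-trans l (ℕ.m≤m+n 8 4)) (squareFree≤active σ) ⟩
          12 + a             ≡⟨ cong (12 +_) eₙ ⟩
          14 + n             ≤⟨ extremal-fourteen n ⟩
          extremal (2 + n)   ≡⟨ cong extremal eₙ ⟨
          extremal a         ∎)

        fourteen : length xs ≤ 14
        fourteen = ℕ.≮⇒≥ λ 15≤ →
          let sub : ∀ {x} → x ∈ take 15 xs → x ∈ xs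
              sub = ∈-take⁻ 15
          in ramsey-W4-W4 (Unique.take⁺ 15 unique)
            (record { R? = E? r ; R-sym = E-sym ; R-irr = E-irr ; total = λ x∈ y∈ → only (sub x∈) (sub y∈) })
            (record { R? = E? b ; R-sym = E-sym ; R-irr = E-irr ; total = λ x∈ y∈ → only′ (sub x∈) (sub y∈) })
            (λ e f → r≢b (E-unique e f))
            (noR ∘ W4-map id id id sub) (noB ∘ W4-map id id id sub)
            (length-take-≤ 15 xs 15≤)

        from-full : lookup σ r ≡ full → lookup σ b ≡ full → ⊥
        from-full eᵣ e_b = unbounded (begin
          length xs + c           ≤⟨ ℕ.+-mono-≤ fourteen c≤n ⟩
          14 + n                  ≤⟨ extremal-fourteen n ⟩
          extremal (2 + n)        ≡⟨ cong extremal eₙ ⟨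
          extremal a              ∎)
          where
          eₛ : lookup (σ [ r ]≔ matching) b ≡ full
          eₛ = trans (Vec.lookup∘update′ (r≢b ∘ sym) σ matching) e_b

          -- Since r and b are full, the C₄-free colours are among the other n active ones.
          c≤n : c ≤ n
          c≤n = subst₂ _≤_
            (trans (squareFree-drop (σ [ r ]≔ matching) b eₛ) (squareFree-drop σ r eᵣ))
            (ℕ.suc-injective (trans (active-drop (σ [ r ]≔ matching) b (full≢ eₛ))
              (ℕ.suc-injective (trans (active-drop σ r (full≢ eᵣ)) eₙ))))
            (squareFree≤active ((σ [ r ]≔ matching) [ b ]≔ matching))

        go : ∀ s t → lookup σ r ≡ s → lookup σ b ≡ t → ⊥
        go full     full     e f = from-full e f
        go matching _        e f = RB.not-matching e
        go _        matching e f = BR.not-matching f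
        go c4       _        e f = from-eight (RB.C4-bounded (avoids e) noB)
        go _        c4       e f = from-eight (BR.C4-bounded (avoids f) noR)

      absurd : ⊥
      absurd with gallai-cut c₁≢c₂ unique (ℕ.≤-trans (ℕ.n≤1+n 2) large)
      ... | r , b , r≢b , cut with search (Foreign? r b xs) xs
      ...   | inj₂ none = not-two-coloured r≢b (no-foreign none)
      ...   | inj₁ (x , x∈ , some) = component x∈ λ comp →
        let open Component comp renaming (A to X)
            y , y∈ , x≢y , ¬xy = find some
            y∈X = case ∈-++⁻ X (∈-resp-↭ parts y∈) of λ where
              (inj₁ y∈X) → y∈X
              (inj₂ y∈Q) → contradiction (cross member y∈Q) ¬xy
        in no-block (proj₂ (proj₂ (make-block r≢b parts cross uncut member (two-length x≢y member y∈X)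
             (remainder cut parts uncut))))
        where
        -- A component exhausting the whole set would be uncut, yet Gallai's theorem has just cut
        -- that set.
        remainder : ∀ {X Q} → Cut r b xs → xs ↭ X ++ Q → Uncut r b X → Inhabited Q
        remainder {X} {[]}    cut p uncut =
          contradiction (Cut-↭ (↭-sym (↭-trans p (↭-reflexive (List.++-identityʳ X)))) cut) uncut
        remainder {X} {q ∷ _} cut p uncut = q , here refl

  bound-fuel : ∀ n {σ xs} → length xs < n → Unique xs → Sat σ xs → Bounded σ xs
  bound-fuel (suc n) {σ} {xs} l unique sat = decidable-stable (_ ℕ.≤? _)
    (Step.Unsplit.absurd {σ} unique sat λ τ u l′ → bound-fuel n {τ} (ℕ.<-≤-trans l′ (ℕ.≤-pred l)) u)

  bound : ∀ σ {xs} → Unique xs → Sat σ xs → Bounded σ xs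
  bound σ = bound-fuel _ {σ} ℕ.≤-refl

-- The lower bound

TwoAgree : {A : Set} → A → A → A → Set
TwoAgree p q r = p ≡ q ⊎ q ≡ r ⊎ p ≡ r

TwoAgree-cong : ∀ {A B : Set} (f : A → B) {p q r} → TwoAgree p q r → TwoAgree (f p) (f q) (f r)
TwoAgree-cong f = Sum.map (cong f) (Sum.map (cong f) (cong f))

two-agree : (p q r : Fin 2) → TwoAgree p q r
two-agree zero       zero       _          = inj₁ refl
two-agree (suc zero) (suc zero) _          = inj₁ refl
two-agree zero       (suc zero) zero       = inj₂ (inj₂ refl)
two-agree zero       (suc zero) (suc zero) = inj₂ (inj₁ refl)
two-agree (suc zero) zero       zero       = inj₂ (inj₁ refl)
two-agree (suc zero) zero       (suc zero) = inj₂ (inj₂ refl)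

record GallaiColouring (V : Set) (k : ℕ) : Set where
  field
    colour    : V → V → Fin k
    colour-sym : ∀ x y → colour x y ≡ colour y x
    gallai : ∀ {x y z} → x ≢ y → y ≢ z → x ≢ z → TwoAgree (colour x y) (colour y z) (colour x z)

W4-free : ∀ {V k} → GallaiColouring V k → Set
W4-free {V} {k} c = ∀ i → ¬ W4 _≢_ (Coloured colour i) (λ _ → ⊤)
  where open GallaiColouring c

Triangle-free : ∀ {V k} → GallaiColouring V k → Set
Triangle-free c = ∀ x y z → x ≢ y → y ≢ z → x ≢ z → colour x y ≡ colour y z → colour y z ≢ colour x z
  where open GallaiColouring c

module _ {U V : Set} (f : U → V) (inj : ∀ {x y} → f x ≡ f y → x ≡ y) {k : ℕ} where
  restrict : GallaiColouring V k → GallaiColouring U k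
  restrict c = record
    { colour = λ x y → colour (f x) (f y) ; colour-sym = λ x y → colour-sym (f x) (f y)
    ; gallai = λ x≢y y≢z x≢z → gallai (x≢y ∘ inj) (y≢z ∘ inj) (x≢z ∘ inj) }
    where open GallaiColouring c

  restrict-W4-free : ∀ {c} → W4-free c → W4-free (restrict c)
  restrict-W4-free free i = free i ∘ W4-map f (λ x≢y → x≢y ∘ inj) (λ (x≢y , e) → x≢y ∘ inj , e) (λ _ → tt)

-- Substituting a colouring for every vertex of another

module Substitution {q p V k} (outer : GallaiColouring (Fin q) p) (inner : GallaiColouring V k) where
  private
    module O = GallaiColouring outer
    module I = GallaiColouring inner

  colour : Fin q × V → Fin q × V → Fin (p + k)
  colour (u , x) (w , y) with u Fin.≟ w
  ... | yes _ = p ↑ʳ I.colour x y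
  ... | no _  = O.colour u w ↑ˡ k

  colour-within : ∀ {u w x y} → u ≡ w → colour (u , x) (w , y) ≡ p ↑ʳ I.colour x y
  colour-within {u} {w} u≡w with u Fin.≟ w
  ... | yes _   = refl
  ... | no u≢w = contradiction u≡w u≢w

  colour-across : ∀ {u w x y} → u ≢ w → colour (u , x) (w , y) ≡ O.colour u w ↑ˡ k
  colour-across {u} {w} u≢w with u Fin.≟ w
  ... | yes u≡w = contradiction u≡w u≢w
  ... | no _    = refl

  substitution : GallaiColouring (Fin q × V) (p + k)
  substitution = record { colour = colour ; colour-sym = symmetric ; gallai = gallai }
    where
    symmetric : ∀ s t → colour s t ≡ colour t s
    symmetric (u , x) (w , y) with u Fin.≟ w
    ... | yes refl = trans (cong (p ↑ʳ_) (I.colour-sym x y)) (sym (colour-within {u} {u} {y} {x} refl))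
    ... | no u≢w   = trans (cong (_↑ˡ k) (O.colour-sym u w)) (sym (colour-across (u≢w ∘ sym)))

    gallai : ∀ {s t r} → s ≢ t → t ≢ r → s ≢ r → TwoAgree (colour s t) (colour t r) (colour s r)
    gallai {u , x} {v , y} {w , z} s≢t t≢r s≢r = decide (u Fin.≟ v) (v Fin.≟ w) (u Fin.≟ w)
      where
      decide : Dec (u ≡ v) → Dec (v ≡ w) → Dec (u ≡ w) → TwoAgree (colour (u , x) (v , y)) (colour (v , y) (w , z)) (colour (u , x) (w , z))
      decide (yes refl) (yes refl) _
        rewrite colour-within {u} {u} {x} {y} refl | colour-within {u} {u} {y} {z} refl | colour-within {u} {u} {x} {z} refl =
        TwoAgree-cong (p ↑ʳ_) (I.gallai (s≢t ∘ cong (u ,_)) (t≢r ∘ cong (u ,_)) (s≢r ∘ cong (u ,_)))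
      decide (yes refl) (no v≢w) _ = inj₂ (inj₁ (trans (colour-across v≢w) (sym (colour-across v≢w))))
      decide (no u≢v) (yes refl) _ = inj₂ (inj₂ (trans (colour-across u≢v) (sym (colour-across u≢v))))
      decide (no u≢v) (no v≢w) (yes refl) =
        inj₁ (trans (colour-across u≢v) (trans (cong (_↑ˡ k) (O.colour-sym u v)) (sym (colour-across v≢w))))
      decide (no u≢v) (no v≢w) (no u≢w)
        rewrite colour-across {u} {v} {x} {y} u≢v | colour-across {v} {w} {y} {z} v≢w | colour-across {u} {w} {x} {z} u≢w =
        TwoAgree-cong (_↑ˡ k) (O.gallai u≢v v≢w u≢w)

  outer≢inner : ∀ (i : Fin p) (j : Fin k) → i ↑ˡ k ≢ p ↑ʳ j
  outer≢inner i j e with trans (sym (Fin.splitAt-↑ˡ p i k)) (trans (cong (splitAt p) e) (Fin.splitAt-↑ʳ p k j))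
  ... | ()

  inner-edge : ∀ {j u w x y} → Coloured colour (p ↑ʳ j) (u , x) (w , y) → u ≡ w × Coloured I.colour j x y
  inner-edge {j} {u} {w} {x} {y} (s≢t , e) with u Fin.≟ w
  ... | yes refl = refl , (s≢t ∘ cong (u ,_)) , Fin.↑ʳ-injective p _ _ e
  ... | no _     = contradiction e (outer≢inner _ j)

  outer-edge : ∀ {j u w x y} → Coloured colour (j ↑ˡ k) (u , x) (w , y) → u ≢ w × O.colour u w ≡ j
  outer-edge {j} {u} {w} {x} {y} (s≢t , e) with u Fin.≟ w
  ... | yes _   = contradiction (sym e) (outer≢inner j _)
  ... | no u≢w = u≢w , Fin.↑ˡ-injective k _ _ e

  -- In an outer colour, `b`, `h`, `a` would span a triangle over three different outer vertices. In
  -- an inner colour adjacent vertices share their outer vertex, so the connected graph W₄ lies in a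
  -- single copy.
  substitution-W4-free : Triangle-free outer → W4-free inner → W4-free substitution
  substitution-W4-free outer-free inner-free i with splitAt p i | Fin.join-splitAt p k i
  ... | inj₁ j | refl = λ (_ , _ , _ , _ , _ , (bh , _) , _ , (ha , ba , _) , _) →
    let b≢h , ebh = outer-edge {j} bh
        h≢a , eha = outer-edge {j} ha
        b≢a , eba = outer-edge {j} ba
    in outer-free _ _ _ b≢h h≢a b≢a (trans ebh (sym eha)) (trans eha (sym eba))
  ... | inj₂ j | refl = within
    where
    within : ¬ W4 _≢_ (Coloured colour (p ↑ʳ j)) (λ _ → ⊤)
    within (_ , _ , _ , (b≢d , _) , _ , (bh , dh , _) , _ , (ha , ba , da , _) , _ , a≢c , (hc , bc , dc , _))
      with inner-edge bh | inner-edge dh | inner-edge ha | inner-edge ba | inner-edge da | inner-edge hc | inner-edge bc | inner-edge dc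
    ... | refl , bh′ | refl , dh′ | refl , ha′ | refl , ba′ | refl , da′ | refl , hc′ | refl , bc′ | refl , dc′ =
      inner-free j (_ , tt , _ , (b≢d ∘ cong (_ ,_) , tt) , _ , (bh′ , dh′ , tt) , _ , (ha′ , ba′ , da′ , tt) ,
                    _ , a≢c ∘ cong (_ ,_) , (hc′ , bc′ , dc′ , tt))

-- This is a circulant when `first` is invariant under d ↦ n - d for 0 < d < n, so the lists below
-- contain each difference with its complement.
differenceColouring : ∀ {n} → (ℕ → Bool) → GallaiColouring (Fin n) 2
differenceColouring first = record
  { colour     = λ x y → if first ∣ toℕ x - toℕ y ∣ then zero else suc zero
  ; colour-sym = λ x y → cong (λ d → if first d then zero else suc zero) (ℕ.∣-∣-comm (toℕ x) (toℕ y))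
  ; gallai  = λ _ _ _ → two-agree _ _ _
  }

coloured? : ∀ {n k} (colour : Fin n → Fin n → Fin k) i x y → Dec (Coloured colour i x y)
coloured? colour i x y = ¬? (x Fin.≟ y) ×-dec (colour x y Fin.≟ i)

distinct? : ∀ {n} (x y : Fin n) → Dec (x ≢ y)
distinct? x y = ¬? (x Fin.≟ y)

-- The circulant colouring with differences ±1, ±2, ±6 modulo 14.
fourteen : GallaiColouring (Fin 14) 2
fourteen = differenceColouring λ d → any (d ≡ᵇ_) (1 ∷ 2 ∷ 6 ∷ 8 ∷ 12 ∷ 13 ∷ [])

fourteen-W4-free : W4-free fourteen
fourteen-W4-free = from-yes (Fin.all? λ i → ¬? (W4? distinct? (coloured? (GallaiColouring.colour fourteen) i) (λ _ → yes tt)))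

-- K₅ as two 5-cycles, the colouring that shows R(3, 3) > 5.
pentagon : GallaiColouring (Fin 5) 2
pentagon = differenceColouring λ d → any (d ≡ᵇ_) (1 ∷ 4 ∷ [])

pentagon-triangle-free : Triangle-free pentagon
pentagon-triangle-free = from-yes (Fin.all? λ x → Fin.all? λ y → Fin.all? λ z →
  distinct? x y →-dec distinct? y z →-dec distinct? x z →-dec
  (colour x y Fin.≟ colour y z) →-dec ¬? (colour y z Fin.≟ colour x z))
  where open GallaiColouring pentagon

edge : GallaiColouring (Fin 2) 1
edge = record { colour = λ _ _ → zero ; colour-sym = λ _ _ → refl ; gallai = λ _ _ _ → inj₁ refl }

edge-triangle-free : Triangle-free edge
edge-triangle-free x y z x≢y y≢z x≢z _ _ with two-agree x y z
... | inj₁ e        = x≢y e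
... | inj₂ (inj₁ e) = y≢z e
... | inj₂ (inj₂ e) = x≢z e

remQuot-injective : ∀ {m} n {i j : Fin (m * n)} → Fin.remQuot {m} n i ≡ Fin.remQuot {m} n j → i ≡ j
remQuot-injective {m} n {i} {j} e =
  trans (sym (Fin.combine-remQuot {m} n i)) (trans (cong (λ (x , y) → Fin.combine x y) e) (Fin.combine-remQuot {m} n j))

multiply : ∀ {q p n k} (outer : GallaiColouring (Fin q) p) → Triangle-free outer →
           ∃ (W4-free {Fin n} {k}) → ∃ (W4-free {Fin (q * n)} {p + k})
multiply {q} {n = n} outer outer-free (inner , inner-free) =
  restrict (Fin.remQuot {q} n) (remQuot-injective n) substitution ,
  restrict-W4-free (Fin.remQuot {q} n) (remQuot-injective n) {c = substitution} (substitution-W4-free outer-free inner-free)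
  where open Substitution outer inner

extremal-colouring : ∀ n → ∃ (W4-free {Fin (extremal (2 + n))} {2 + n})
extremal-colouring 0             = fourteen , fourteen-W4-free
extremal-colouring 1             = multiply edge edge-triangle-free (fourteen , fourteen-W4-free)
extremal-colouring (suc (suc n)) = multiply pentagon pentagon-triangle-free (extremal-colouring n)

-- The Gallai-Ramsey number

symmetric : ∀ {N k} (c : Colouring N k) x y → col c x y ≡ col c y x
symmetric c x y with x Fin.≟ y
... | yes refl = refl
... | no x≢y   = symm c x y x≢y

fromColouring : ∀ {N k} (c : Colouring N k) → Gallai c → GallaiColouring (Fin N) k
fromColouring c gallai = record { colour = col c ; colour-sym = symmetric c ; gallai = agree }
  where
  agree : ∀ {x y z} → x ≢ y → y ≢ z → x ≢ z → TwoAgree (col c x y) (col c y z) (col c x z)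
  agree {x} {y} {z} x≢y y≢z x≢z
    with col c x y Fin.≟ col c y z | col c y z Fin.≟ col c x z | col c x y Fin.≟ col c x z
  ... | yes e | _     | _     = inj₁ e
  ... | _     | yes e | _     = inj₂ (inj₁ e)
  ... | _     | _     | yes e = inj₂ (inj₂ e)
  ... | no p  | no q  | no r  = contradiction (x≢y , y≢z , x≢z , p , q , r) (gallai x y z)

toColouring : ∀ {N k} → GallaiColouring (Fin N) k → Colouring N k
toColouring c = record { col = G.colour ; symm = λ x y _ → G.colour-sym x y }
  where module G = GallaiColouring c

toColouring-Gallai : ∀ {N k} (c : GallaiColouring (Fin N) k) → Gallai (toColouring c)
toColouring-Gallai c x y z (x≢y , y≢z , x≢z , p , q , r) with GallaiColouring.gallai c x≢y y≢z x≢z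
... | inj₁ e        = p e
... | inj₂ (inj₁ e) = q e
... | inj₂ (inj₂ e) = r e

-- The middle `h` of the path is the hub, and a, b, e, d in this order are the rim, with b and d
-- opposite.
W4⇒MonoW4 : ∀ {N k} (c : Colouring N k) {i} → W4 _≢_ (Coloured (col c) i) (λ _ → ⊤) → MonoW4 c
W4⇒MonoW4 {N} c {i} (b , _ , d , (b≢d , _) , h , ((b≢h , bh) , (d≢h , dh) , _) ,
                     a , ((h≢a , ha) , (b≢a , ba) , (d≢a , da) , _) ,
                     e , a≢e , ((h≢e , he) , (b≢e , be) , (d≢e , de) , _)) =
  lookup wheel , (λ {x} {y} → lookup-injective wheel-unique x y) , i , edges
  where
  wheel : Vec (Fin N) 5
  wheel = h ∷ a ∷ b ∷ e ∷ d ∷ []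

  flip : ∀ {x y} → col c x y ≡ i → col c y x ≡ i
  flip {x} {y} = trans (symmetric c y x)

  wheel-unique : UniqueVec wheel
  wheel-unique = (h≢a ∷ ≢-sym b≢h ∷ h≢e ∷ ≢-sym d≢h ∷ []) ∷ (≢-sym b≢a ∷ a≢e ∷ ≢-sym d≢a ∷ []) ∷
                 (b≢e ∷ b≢d ∷ []) ∷ (≢-sym d≢e ∷ []) ∷ [] ∷ []

  edges : ∀ u v → W4Edge u v → col c (lookup wheel u) (lookup wheel v) ≡ i
  edges _ _ spoke1 = ha
  edges _ _ spoke2 = flip bh
  edges _ _ spoke3 = he
  edges _ _ spoke4 = flip dh
  edges _ _ rim12  = flip ba
  edges _ _ rim23  = be
  edges _ _ rim34  = flip de
  edges _ _ rim41  = da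

MonoW4⇒W4 : ∀ {N k} (c : Colouring N k) → MonoW4 c → ∃ λ i → W4 _≢_ (Coloured (col c) i) (λ _ → ⊤)
MonoW4⇒W4 c (f , inj , i , edges) =
  i , f (# 2) , tt , f (# 4) , (distinct (λ ()) , tt) ,
  f (# 0) , (reverse spoke2 (λ ()) , reverse spoke4 (λ ()) , tt) ,
  f (# 1) , (direct spoke1 (λ ()) , reverse rim12 (λ ()) , direct rim41 (λ ()) , tt) ,
  f (# 3) , distinct (λ ()) , (direct spoke3 (λ ()) , direct rim23 (λ ()) , reverse rim34 (λ ()) , tt)
  where
  distinct : ∀ {x y} → x ≢ y → f x ≢ f y
  distinct x≢y = x≢y ∘ inj

  direct : ∀ {x y} → W4Edge x y → x ≢ y → Coloured (col c) i (f x) (f y)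
  direct e x≢y = distinct x≢y , edges _ _ e

  reverse : ∀ {x y} → W4Edge x y → y ≢ x → Coloured (col c) i (f y) (f x)
  reverse e y≢x = distinct y≢x , trans (symmetric c _ _) (edges _ _ e)

weight-full : ∀ {w m} k → w full ≡ m → weight w (Vec.replicate k full) ≡ k * m
weight-full zero    e = refl
weight-full (suc k) e = cong₂ _+_ e (weight-full k e)

W4-free-bounded : ∀ {N k} {i j : Fin k} → i ≢ j → (c : GallaiColouring (Fin N) k) → W4-free c → N ≤ extremal k
W4-free-bounded {N} {k} i≢j c free = subst₂ _≤_
  (trans (cong₂ _+_ (List.length-tabulate id) (trans (weight-full {squareFree} k refl) (ℕ.*-zeroʳ k))) (ℕ.+-identityʳ N))
  (cong extremal (trans (weight-full {active} k refl) (ℕ.*-identityʳ k)))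
  (Bound.bound Fin._≟_ G.colour G.colour-sym G.gallai i≢j (Vec.replicate k full) (Unique.allFin⁺ N)
    λ i → subst (λ s → Bound.Avoids Fin._≟_ G.colour G.colour-sym G.gallai i≢j s i _) (sym (Vec.lookup-replicate i full))
            (free i ∘ W4-map id id id (λ _ → tt)))
  where module G = GallaiColouring c

arrows : ∀ {k} {i j : Fin k} → i ≢ j → ∀ {N} → extremal k < N → Arrows k N
arrows i≢j N> c gallai
  with Fin.any? (λ i → W4? distinct? (coloured? (col c) i) (λ _ → yes tt))
... | yes (_ , w) = W4⇒MonoW4 c w
... | no none     = contradiction (W4-free-bounded i≢j (fromColouring c gallai) λ i w → none (i , w)) (ℕ.<⇒≱ N>)

not-arrows : ∀ n {M} → M ≤ extremal (2 + n) → ¬ Arrows (2 + n) M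
not-arrows n {M} M≤ arrow =
  let c , free = extremal-colouring n
      f = λ (x : Fin M) → Fin.inject≤ x M≤
      inj = λ {x y} → Fin.inject≤-injective M≤ M≤ x y
      c′ = restrict f inj c
      i , w = MonoW4⇒W4 (toColouring c′) (arrow (toColouring c′) (toColouring-Gallai c′))
  in restrict-W4-free f inj {c = c} free i w

-- By computation the left side is the division helper run on `n` with accumulator one, and the
-- accumulator is then pulled out.
half : ∀ n → (2 + n) / 2 ≡ suc (n / 2)
half n = divₕ-extractAcc 1 1 n 1

scale : ∀ c n {x} → c * 5 ^ (n / 2) + 1 ≡ x + 1 → c * 5 ^ ((2 + n) / 2) + 1 ≡ 5 * x + 1
scale c n {x} e = cong (_+ 1) (trans (cong (λ m → c * 5 ^ m) (half n))
  (trans (exchange c (5 ^ (n / 2))) (cong (5 *_) (ℕ.+-cancelʳ-≡ 1 _ x e))))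
  where
  exchange : ∀ c m → c * (5 * m) ≡ 5 * (c * m)
  exchange = solve-∀

-- Parity is the same two steps further by computation, so one `with` settles both values. The case
-- `zero` stands apart because the truncated `k ∸ 3` follows k only from 3 on.
grW4Value-step : ∀ n {x} → grW4Value (2 + n) ≡ x + 1 → grW4Value (4 + n) ≡ 5 * x + 1
grW4Value-step zero e = scale 14 0 e
grW4Value-step (suc n) e with suc n % 2
... | zero  = scale 14 (suc n) e
... | suc _ = scale 28 n e

grW4Value≡extremal : ∀ n → grW4Value (2 + n) ≡ extremal (2 + n) + 1
grW4Value≡extremal 0             = refl
grW4Value≡extremal 1             = refl
grW4Value≡extremal (suc (suc n)) = grW4Value-step n (grW4Value≡extremal n)

theorem2p3 : (k : ℕ) → 2 ≤ k → IsGR-W4 k (grW4Value k)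
theorem2p3 (suc zero)    (s≤s ())
theorem2p3 (suc (suc n)) _ rewrite grW4Value≡extremal n | ℕ.+-comm (extremal (2 + n)) 1 =
  s≤s z≤n ,
  arrows {i = zero} {j = suc zero} (λ ()) ℕ.≤-refl ,
  λ M _ arrow → ℕ.≰⇒> λ M≤ → not-arrows n M≤ arrow
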